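{- Let $g, h: \mathbb{Z}^{n} \to \mathbb{Z} \cup \{ +\infty \}$ be integer-valued integrally convex functions (with nonempty effective domains). Then $$\inf_{x \in \mathbb{Z}^{n}} \{ g(x) - h(x) \} = \inf_{p \in \mathbb{Z}^{n}} \{ h^{\bullet}(p) - g^{\bullet}(p) \}.$$
   Context: The integral conjugate of $f:\mathbb{Z}^n\to\mathbb{Z}\cup\{+\infty\}$ is $f^{\bullet}(p) = \sup\{ \langle p, x \rangle - f(x) \mid x \in \mathbb{Z}^{n} \}$ for $p \in \mathbb{Z}^{n}$. For $x \in \mathbb{R}^{n}$, $N(x) = \{ z \in \mathbb{Z}^{n} \mid |x_{i} - z_{i}| < 1 \ (i=1,\ldots,n)\}$; the local convex extension of $f$ is $\tilde f(x) = \min\{ \sum_{y \in N(x)} \lambda_{y} f(y) \mid \sum_{y \in N(x)} \lambda_{y} y = x,\ \sum_{y} \lambda_y = 1,\ \lambda_y \ge 0\}$, and $f$ is integrally convex if $\tilde f$ is convex on $\mathbb{R}^n$. The effective domain $\{x\in\mathbb{Z}^n \mid f(x)<+\infty\}$ is assumed nonempty for all functions considered. -}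

module Defs where

open import Data.Nat using (ℕ)
open import Data.Integer as ℤ using (ℤ)
open import Data.Rational as ℚ using (ℚ; 0ℚ; 1ℚ)
open import Data.Vec using (Vec; []; _∷_; foldr; zipWith; map)
open import Data.List using (List)
open import Data.List.Relation.Unary.All using (All)
open import Data.Product using (Σ; _×_; ∃)
open import Data.Sum using (_⊎_)
open import Relation.Binary.PropositionalEquality using (_≡_)
open import Relation.Nullary using (¬_)

data ℤ∞ : Set where
  fin : ℤ → ℤ∞
  +∞  : ℤ∞

data Ext : Set where
  -∞   : Ext
  val  : ℤ → Ext
  +∞ₑ  : Ext

embed : ℤ∞ → Ext
embed (fin a) = val a
embed +∞      = +∞ₑ

data _≤ₑ_ : Ext → Ext → Set where
  -∞≤   : ∀ {v} → -∞ ≤ₑ v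
  val≤  : ∀ {a b} → a ℤ.≤ b → val a ≤ₑ val b
  ≤+∞   : ∀ {v} → v ≤ₑ +∞ₑ

-- subtraction with the convention (+∞) - (+∞) = +∞ (Toland–Singer convention)
_⊖_ : Ext → Ext → Ext
+∞ₑ   ⊖ _     = +∞ₑ
_     ⊖ -∞    = +∞ₑ
-∞    ⊖ _     = -∞
val a ⊖ val b = val (a ℤ.- b)
val a ⊖ +∞ₑ   = -∞

IsInf : {I : Set} → (I → Ext) → Ext → Set
IsInf {I} S v = (∀ i → v ≤ₑ S i) × (∀ w → (∀ i → w ≤ₑ S i) → w ≤ₑ v)

IsSup : {I : Set} → (I → Ext) → Ext → Set
IsSup {I} S v = (∀ i → S i ≤ₑ v) × (∀ w → (∀ i → S i ≤ₑ w) → v ≤ₑ w)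

⟨_,_⟩ : ∀ {n} → Vec ℤ n → Vec ℤ n → ℤ
⟨ p , x ⟩ = foldr _ ℤ._+_ (ℤ.+ 0) (zipWith ℤ._*_ p x)

NonemptyDom : ∀ {n} → (Vec ℤ n → ℤ∞) → Set
NonemptyDom {n} f = Σ (Vec ℤ n) λ x → Σ ℤ λ a → f x ≡ fin a

IsConjugateAt : ∀ {n} → (Vec ℤ n → ℤ∞) → Vec ℤ n → Ext → Set
IsConjugateAt f p v = IsSup (λ x → val ⟨ p , x ⟩ ⊖ embed (f x)) v

-- Local convex extension and integral convexity
-- (points of ℝⁿ are taken in ℚⁿ)

ιℤ : ℤ → ℚ
ιℤ z = z ℚ./ 1

ιv : ∀ {n} → Vec ℤ n → Vec ℚ n
ιv = map ιℤ

sumℚ : ∀ {n} → Vec ℚ n → ℚ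
sumℚ = foldr _ ℚ._+_ 0ℚ

_⊕_ : ∀ {n} → Vec ℚ n → Vec ℚ n → Vec ℚ n
_⊕_ = zipWith ℚ._+_

_·_ : ∀ {n} → ℚ → Vec ℚ n → Vec ℚ n
t · x = map (t ℚ.*_) x

zeroV : ∀ n → Vec ℚ n
zeroV ℕ.zero    = []
zeroV (ℕ.suc n) = 0ℚ ∷ zeroV n

data InN : ∀ {n} → Vec ℚ n → Vec ℤ n → Set where
  []  : InN [] []
  _∷_ : ∀ {n a c} {x : Vec ℚ n} {z : Vec ℤ n} →
        ℚ.∣ a ℚ.- ιℤ c ∣ ℚ.< 1ℚ → InN x z → InN (a ∷ x) (c ∷ z)

record Term (n : ℕ) : Set where
  constructor term
  field
    pt     : Vec ℤ n
    weight : ℚ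
    value  : ℤ
open Term public

-- finite family (λ_y) of positive weights on points y ∈ N(x) ∩ dom f with
-- Σ λ_y y = x, Σ λ_y = 1  (points with λ_y = 0 are omitted; a representation
-- using a point outside dom f with positive weight has cost +∞ and is irrelevant)
Feasible : ∀ {n} → (Vec ℤ n → ℤ∞) → Vec ℚ n → List (Term n) → Set
Feasible {n} f x ts =
  All (λ t → InN x (pt t) × (0ℚ ℚ.< weight t) × (f (pt t) ≡ fin (value t))) ts
  × (Data.List.foldr (λ t acc → (weight t · ιv (pt t)) ⊕ acc) (zeroV n) ts ≡ x)
  × (Data.List.foldr (λ t acc → weight t ℚ.+ acc) 0ℚ ts ≡ 1ℚ)

cost : ∀ {n} → List (Term n) → ℚ
cost = Data.List.foldr (λ t acc → (weight t ℚ.* ιℤ (value t)) ℚ.+ acc) 0ℚ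

data ℚ∞ : Set where
  finq : ℚ → ℚ∞
  +∞q  : ℚ∞

IsLocExt : ∀ {n} → (Vec ℤ n → ℤ∞) → Vec ℚ n → ℚ∞ → Set
IsLocExt {n} f x +∞q      = ∀ ts → ¬ Feasible f x ts
IsLocExt {n} f x (finq q) =
  (Σ (List (Term n)) λ ts → Feasible f x ts × cost ts ≡ q)
  × (∀ ts → Feasible f x ts → q ℚ.≤ cost ts)

data _≤q_ : ℚ∞ → ℚ∞ → Set where
  fin≤ : ∀ {a b} → a ℚ.≤ b → finq a ≤q finq b
  ≤∞   : ∀ {v} → v ≤q +∞q

-- t·u + (1-t)·w  in ℚ ∪ {+∞}, used only for 0 < t < 1
comb : ℚ → ℚ∞ → ℚ∞ → ℚ∞
comb t (finq a) (finq b) = finq ((t ℚ.* a) ℚ.+ ((1ℚ ℚ.- t) ℚ.* b))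
comb t _ _ = +∞q

IntegrallyConvex : ∀ {n} → (Vec ℤ n → ℤ∞) → Set
IntegrallyConvex {n} f =
  ∀ (x y : Vec ℚ n) (t : ℚ) (u w v : ℚ∞) →
  0ℚ ℚ.< t → t ℚ.< 1ℚ →
  IsLocExt f x u → IsLocExt f y w →
  IsLocExt f ((t · x) ⊕ ((1ℚ ℚ.- t) · y)) v →
  v ≤q comb t u w

{-# OPTIONS --safe #-}
-- The inequality inf (g − h) ≤ inf (h• − g•) is weak duality. For the converse it is enough that h
-- has, at every x with h x finite, an integral subgradient, and at every x with h x = +∞, integral
-- affine minorants that are arbitrarily large at x.
--
-- Subgradient. The inequalities ⟨p, y − x⟩ ≤ h y − h x for y ∈ x + {−1,0,1}ⁿ are solved by
-- Fourier–Motzkin elimination. Eliminating a coordinate adds up the inequality of a point y with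
-- that coordinate one below x and of a point z with that coordinate one above x. By integral
-- convexity at the midpoint, the sum is implied by the inequalities of the points of N((y + z)/2),
-- which have the same coordinate as x. So no new inequalities arise, all coefficients stay in
-- {−1,0,1}, and every bound on the next coordinate of p is an integer. Integral convexity near x
-- on the segment towards y then extends the inequality from the neighbours of x to all y.
--
-- Points with h x = +∞. Let x₀ be a point of dom h with no neighbour in dom h that is L¹-closer
-- to x. If x − x₀ were in the cone of the feasible directions at x₀, then a point slightly
-- off x₀ towards x would be a convex combination of points of dom h that are equal to x₀ or closer
-- to x. So Weyl's theorem gives q with ⟨q, x − x₀⟩ > 0 and ⟨q, d⟩ ≤ 0 for all feasible d, and large
-- multiples of q are added to a subgradient at x₀.
--
-- Weyl's theorem also shows that the minimum defining the local convex extension is attained.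
module Submission where

open import Defs
open import Data.Empty using (⊥-elim)
open import Data.Integer as ℤ using (ℤ)
import Data.Integer.DivMod as ℤD
import Data.Integer.Properties as ℤP
open import Data.Integer.Solver renaming (module +-*-Solver to ℤ-Solver)
open ℤ-Solver using () renaming
  (solve to ℤ-solve; _:=_ to _≐_; _:+_ to _⊞_; _:*_ to _⊠_; _:-_ to _⊟_; con to ℤ-con)
open import Data.List as List using (List; []; _∷_; _++_)
open import Data.List.Membership.Propositional using (_∈_; find)
open import Data.List.Membership.Propositional.Properties
  using (∈-map⁺; ∈-++⁺ˡ; ∈-++⁺ʳ; ∈-++⁻; ∈-concatMap⁺; ∈-filter⁺; ∈-filter⁻;
         ∈-cartesianProductWith⁺; ∈-cartesianProductWith⁻)
open import Data.List.Relation.Unary.All as All using (All; []; _∷_)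
open import Data.List.Relation.Unary.Any as Any using (here; there)
open import Data.Nat as ℕ using (ℕ; zero; suc)
open import Data.Nat.Induction using (<-wellFounded)
import Data.Nat.Properties as ℕP
open import Data.Product using (Σ; _×_; _,_; proj₁; proj₂)
open import Data.Rational as ℚ using (ℚ; 0ℚ; 1ℚ; _+_; _*_; _-_; -_; _≤_; _<_)
import Data.Rational.Properties as ℚP
open import Data.Rational.Solver using (module +-*-Solver)
open +-*-Solver using (solve; _:=_; _:+_; _:*_; _:-_; :-_; con)
import Data.Rational.Unnormalised as ℚᵘ
import Data.Rational.Unnormalised.Properties as ℚᵘP
open import Data.Sum using (_⊎_; inj₁; inj₂)
open import Data.Vec as Vec using (Vec; []; _∷_)
open import Function using (_∘_)
open import Induction.WellFounded using (Acc; acc)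
open import Relation.Binary.Definitions using (Tri; tri<; tri≈; tri>)
open import Relation.Binary.PropositionalEquality
open import Relation.Nullary using (¬_; Dec; yes; no)
open import Relation.Nullary.Decidable using (map′; _×-dec_)

private variable
  n : ℕ

-- Rational and integer arithmetic

*-nonNeg : ∀ {p q} → 0ℚ ≤ p → 0ℚ ≤ q → 0ℚ ≤ p * q
*-nonNeg {p} {q} 0≤p 0≤q = subst (_≤ p * q) (ℚP.*-zeroʳ p)
  (ℚP.*-monoˡ-≤-nonNeg p {{ℚ.nonNegative 0≤p}} 0≤q)

*-pos : ∀ {p q} → 0ℚ < p → 0ℚ < q → 0ℚ < p * q
*-pos {p} {q} 0<p 0<q = subst (_< p * q) (ℚP.*-zeroʳ p)
  (ℚP.*-monoʳ-<-pos p {{ℚ.positive 0<p}} 0<q)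

+-nonNeg : ∀ {p q} → 0ℚ ≤ p → 0ℚ ≤ q → 0ℚ ≤ p + q
+-nonNeg = ℚP.+-mono-≤

-- A linear inequality p ≤ q is proved by writing q − p as a nonnegative combination of the gaps of
-- known inequalities, which leaves a ring identity.
gap≤ : ∀ {p q} → p ≤ q → 0ℚ ≤ q - p
gap≤ {p} {q} p≤q = subst (_≤ q - p) (ℚP.+-inverseʳ p) (ℚP.+-monoˡ-≤ (- p) p≤q)

gap< : ∀ {p q} → p < q → 0ℚ < q - p
gap< {p} {q} p<q = subst (_< q - p) (ℚP.+-inverseʳ p) (ℚP.+-monoˡ-< (- p) p<q)

gap≤⁻¹ : ∀ {p q d} → 0ℚ ≤ d → q ≡ p + d → p ≤ q
gap≤⁻¹ {p} {d = d} 0≤d refl = subst (_≤ p + d) (ℚP.+-identityʳ p) (ℚP.+-monoʳ-≤ p 0≤d)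

gap<⁻¹ : ∀ {p q d} → 0ℚ < d → q ≡ p + d → p < q
gap<⁻¹ {p} {d = d} 0<d refl = subst (_< p + d) (ℚP.+-identityʳ p) (ℚP.+-monoʳ-< p 0<d)

ℚ<⇒≱ : ∀ {p q} → p < q → ¬ (q ≤ p)
ℚ<⇒≱ p<q q≤p = ℚP.<-irrefl refl (ℚP.<-≤-trans p<q q≤p)

ιℤ-toℚᵘ : ∀ a → ℚ.toℚᵘ (ιℤ a) ℚᵘ.≃ ℚᵘ.mkℚᵘ a 0
ιℤ-toℚᵘ a = ℚP.toℚᵘ-fromℚᵘ (ℚᵘ.mkℚᵘ a 0)

ιℤ-+ : ∀ a b → ιℤ (a ℤ.+ b) ≡ ιℤ a + ιℤ b
ιℤ-+ a b = ℚP.toℚᵘ-injective (begin-equality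
  ℚ.toℚᵘ (ιℤ (a ℤ.+ b))               ≃⟨ ιℤ-toℚᵘ (a ℤ.+ b) ⟩
  ℚᵘ.mkℚᵘ (a ℤ.+ b) 0                  ≃⟨ ℚᵘP.≃-reflexive (cong₂ (λ x y → ℚᵘ.mkℚᵘ (x ℤ.+ y) 0)
                                            (sym (ℤP.*-identityʳ a)) (sym (ℤP.*-identityʳ b))) ⟩
  ℚᵘ.mkℚᵘ a 0 ℚᵘ.+ ℚᵘ.mkℚᵘ b 0         ≃⟨ ℚᵘP.+-cong (ιℤ-toℚᵘ a) (ιℤ-toℚᵘ b) ⟨
  ℚ.toℚᵘ (ιℤ a) ℚᵘ.+ ℚ.toℚᵘ (ιℤ b)     ≃⟨ ℚP.toℚᵘ-homo-+ (ιℤ a) (ιℤ b) ⟨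
  ℚ.toℚᵘ (ιℤ a + ιℤ b)                 ∎)
  where open ℚᵘP.≤-Reasoning

ιℤ-* : ∀ a b → ιℤ (a ℤ.* b) ≡ ιℤ a * ιℤ b
ιℤ-* a b = ℚP.toℚᵘ-injective (begin-equality
  ℚ.toℚᵘ (ιℤ (a ℤ.* b))               ≃⟨ ιℤ-toℚᵘ (a ℤ.* b) ⟩
  ℚᵘ.mkℚᵘ a 0 ℚᵘ.* ℚᵘ.mkℚᵘ b 0         ≃⟨ ℚᵘP.*-cong (ιℤ-toℚᵘ a) (ιℤ-toℚᵘ b) ⟨
  ℚ.toℚᵘ (ιℤ a) ℚᵘ.* ℚ.toℚᵘ (ιℤ b)     ≃⟨ ℚP.toℚᵘ-homo-* (ιℤ a) (ιℤ b) ⟨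
  ℚ.toℚᵘ (ιℤ a * ιℤ b)                 ∎)
  where open ℚᵘP.≤-Reasoning

ιℤ-neg : ∀ a → ιℤ (ℤ.- a) ≡ - ιℤ a
ιℤ-neg a = ℚP.toℚᵘ-injective (begin-equality
  ℚ.toℚᵘ (ιℤ (ℤ.- a))     ≃⟨ ιℤ-toℚᵘ (ℤ.- a) ⟩
  ℚᵘ.- ℚᵘ.mkℚᵘ a 0        ≃⟨ ℚᵘP.-‿cong (ιℤ-toℚᵘ a) ⟨
  ℚᵘ.- ℚ.toℚᵘ (ιℤ a)      ≃⟨ ℚP.toℚᵘ-homo‿- (ιℤ a) ⟨
  ℚ.toℚᵘ (- ιℤ a)         ∎)
  where open ℚᵘP.≤-Reasoning

ιℤ-- : ∀ a b → ιℤ (a ℤ.- b) ≡ ιℤ a - ιℤ b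
ιℤ-- a b = trans (ιℤ-+ a (ℤ.- b)) (cong (ιℤ a +_) (ιℤ-neg b))

ιℤ-mono-≤ : ∀ {a b} → a ℤ.≤ b → ιℤ a ≤ ιℤ b
ιℤ-mono-≤ {a} {b} a≤b = ℚP.toℚᵘ-cancel-≤ (begin
  ℚ.toℚᵘ (ιℤ a)  ≃⟨ ιℤ-toℚᵘ a ⟩
  ℚᵘ.mkℚᵘ a 0    ≤⟨ ℚᵘ.*≤* (ℤP.*-monoʳ-≤-nonNeg (ℤ.+ 1) a≤b) ⟩
  ℚᵘ.mkℚᵘ b 0    ≃⟨ ιℤ-toℚᵘ b ⟨
  ℚ.toℚᵘ (ιℤ b)  ∎)
  where open ℚᵘP.≤-Reasoning

ιℤ-cancel-≤ : ∀ {a b} → ιℤ a ≤ ιℤ b → a ℤ.≤ b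
ιℤ-cancel-≤ {a} {b} ιa≤ιb = ℤP.*-cancelʳ-≤-pos a b (ℤ.+ 1) (ℚᵘP.drop-*≤* (begin
  ℚᵘ.mkℚᵘ a 0    ≃⟨ ιℤ-toℚᵘ a ⟨
  ℚ.toℚᵘ (ιℤ a)  ≤⟨ ℚP.toℚᵘ-mono-≤ ιa≤ιb ⟩
  ℚ.toℚᵘ (ιℤ b)  ≃⟨ ιℤ-toℚᵘ b ⟩
  ℚᵘ.mkℚᵘ b 0    ∎))
  where open ℚᵘP.≤-Reasoning

ιℤ-cancel-< : ∀ {a b} → ιℤ a < ιℤ b → a ℤ.< b
ιℤ-cancel-< {a} {b} lt = ℤP.≰⇒> λ b≤a → ℚ<⇒≱ lt (ιℤ-mono-≤ b≤a)

ιℤ-mono-< : ∀ {a b} → a ℤ.< b → ιℤ a < ιℤ b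
ιℤ-mono-< {a} {b} lt = ℚP.≰⇒> λ b≤a → ℤP.<⇒≱ lt (ιℤ-cancel-≤ b≤a)

divide : ∀ {α} → 0ℚ < α → ∀ β → Σ ℚ λ s → s * α ≡ β
divide {α} 0<α β = β * ℚ.1/ α , (begin
    β * ℚ.1/ α * α    ≡⟨ ℚP.*-assoc β (ℚ.1/ α) α ⟩
    β * (ℚ.1/ α * α)  ≡⟨ cong (β *_) (ℚP.*-inverseˡ α) ⟩
    β * 1ℚ            ≡⟨ ℚP.*-identityʳ β ⟩
    β                 ∎)
  where
  open ≡-Reasoning
  instance α≢0 = ℚP.pos⇒nonZero α {{ℚ.positive 0<α}}

-- Finitely generated cones

infixl 7 _∙_
_∙_ : Vec ℚ n → Vec ℚ n → ℚ
[]      ∙ []      = 0ℚ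
(a ∷ u) ∙ (b ∷ v) = a * b + u ∙ v

∙-comm : (u v : Vec ℚ n) → u ∙ v ≡ v ∙ u
∙-comm []      []      = refl
∙-comm (a ∷ u) (b ∷ v) = cong₂ _+_ (ℚP.*-comm a b) (∙-comm u v)

∙-distribˡ-⊕ : (u v w : Vec ℚ n) → u ∙ (v ⊕ w) ≡ u ∙ v + u ∙ w
∙-distribˡ-⊕ []      []      []      = refl
∙-distribˡ-⊕ (a ∷ u) (b ∷ v) (c ∷ w) rewrite ∙-distribˡ-⊕ u v w =
  solve 5 (λ a b c x y → a :* (b :+ c) :+ (x :+ y) := a :* b :+ x :+ (a :* c :+ y)) refl
    a b c (u ∙ v) (u ∙ w)

∙-·ʳ : (t : ℚ) (u v : Vec ℚ n) → u ∙ (t · v) ≡ t * (u ∙ v)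
∙-·ʳ t []      []      = sym (ℚP.*-zeroʳ t)
∙-·ʳ t (a ∷ u) (b ∷ v) rewrite ∙-·ʳ t u v =
  solve 4 (λ t a b x → a :* (t :* b) :+ t :* x := t :* (a :* b :+ x)) refl t a b (u ∙ v)

∙-distribʳ-⊕ : (w u v : Vec ℚ n) → (u ⊕ v) ∙ w ≡ u ∙ w + v ∙ w
∙-distribʳ-⊕ w u v = trans (∙-comm (u ⊕ v) w)
  (trans (∙-distribˡ-⊕ w u v) (cong₂ _+_ (∙-comm w u) (∙-comm w v)))

∙-·ˡ : (t : ℚ) (u v : Vec ℚ n) → (t · u) ∙ v ≡ t * (u ∙ v)
∙-·ˡ t u v = trans (∙-comm (t · u) v) (trans (∙-·ʳ t v u) (cong (t *_) (∙-comm v u)))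

∙-zeroˡ : (v : Vec ℚ n) → zeroV n ∙ v ≡ 0ℚ
∙-zeroˡ []      = refl
∙-zeroˡ (b ∷ v) rewrite ∙-zeroˡ v = trans (ℚP.+-identityʳ _) (ℚP.*-zeroˡ b)

∙-zeroʳ : (v : Vec ℚ n) → v ∙ zeroV n ≡ 0ℚ
∙-zeroʳ v = trans (∙-comm v _) (∙-zeroˡ v)

⊕-identityˡ : (v : Vec ℚ n) → zeroV n ⊕ v ≡ v
⊕-identityˡ []      = refl
⊕-identityˡ (a ∷ v) = cong₂ _∷_ (ℚP.+-identityˡ a) (⊕-identityˡ v)

⊕-comm : (u v : Vec ℚ n) → u ⊕ v ≡ v ⊕ u
⊕-comm []      []      = refl
⊕-comm (a ∷ u) (b ∷ v) = cong₂ _∷_ (ℚP.+-comm a b) (⊕-comm u v)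

⊕-assoc : (u v w : Vec ℚ n) → (u ⊕ v) ⊕ w ≡ u ⊕ (v ⊕ w)
⊕-assoc []      []      []      = refl
⊕-assoc (a ∷ u) (b ∷ v) (c ∷ w) = cong₂ _∷_ (ℚP.+-assoc a b c) (⊕-assoc u v w)

·-zeroˡ : (v : Vec ℚ n) → 0ℚ · v ≡ zeroV n
·-zeroˡ []      = refl
·-zeroˡ (a ∷ v) = cong₂ _∷_ (ℚP.*-zeroˡ a) (·-zeroˡ v)

·-identityˡ : (v : Vec ℚ n) → 1ℚ · v ≡ v
·-identityˡ []      = refl
·-identityˡ (a ∷ v) = cong₂ _∷_ (ℚP.*-identityˡ a) (·-identityˡ v)

·-distribʳ : (s t : ℚ) (v : Vec ℚ n) → (s + t) · v ≡ (s · v) ⊕ (t · v)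
·-distribʳ s t []      = refl
·-distribʳ s t (a ∷ v) = cong₂ _∷_ (ℚP.*-distribʳ-+ a s t) (·-distribʳ s t v)

-- One generator and its multiplier are split off at a time, so that a description by inequalities
-- arises by eliminating one multiplier after another.
InCone : List (Vec ℚ n) → Vec ℚ n → Set
InCone         []      v = v ≡ zeroV _
InCone {n = n} (a ∷ A) v = Σ ℚ λ t → 0ℚ ≤ t × Σ (Vec ℚ n) λ w → InCone A w × v ≡ (t · a) ⊕ w

InPolar : List (Vec ℚ n) → Vec ℚ n → Set
InPolar U v = ∀ {u} → u ∈ U → u ∙ v ≤ 0ℚ

-- Plus and minus the unit vectors: their polar is the origin, the cone with no generators.
axes : ∀ n → List (Vec ℚ n)
axes zero    = []
axes (suc n) = (1ℚ ∷ zeroV n) ∷ (- 1ℚ ∷ zeroV n) ∷ List.map (0ℚ ∷_) (axes n)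

polar-axes : (v : Vec ℚ n) → InPolar (axes n) v → v ≡ zeroV n
polar-axes []      _ = refl
polar-axes (a ∷ v) h = cong₂ _∷_
  (ℚP.≤-antisym
    (subst (_≤ 0ℚ) (trans (cong (1ℚ * a +_) (∙-zeroˡ v)) (solve 1 (λ a → con 1ℚ :* a :+ con 0ℚ := a) refl a))
      (h (here refl)))
    (gap≤⁻¹ (gap≤ (h (there (here refl))))
      (trans (solve 1 (λ a → a := con 0ℚ :+ (con 0ℚ :- ((:- con 1ℚ) :* a :+ con 0ℚ))) refl a)
        (cong (λ x → 0ℚ + (0ℚ - (- 1ℚ * a + x))) (sym (∙-zeroˡ v))))))
  (polar-axes v λ {u} u∈ → subst (_≤ 0ℚ)
    (trans (cong (_+ u ∙ v) (ℚP.*-zeroˡ a)) (ℚP.+-identityˡ _))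
    (h (there (there (∈-map⁺ (0ℚ ∷_) u∈)))))

-- Minimality of t is recorded by its being 0 or attained.
least-multiplier : (a v : Vec ℚ n) (P : List (Vec ℚ n)) → (∀ {u} → u ∈ P → 0ℚ < u ∙ a) →
  Σ ℚ λ t → 0ℚ ≤ t × (∀ {u} → u ∈ P → u ∙ v ≤ t * (u ∙ a))
    × (t ≡ 0ℚ ⊎ Σ (Vec ℚ n) λ u → u ∈ P × u ∙ v ≡ t * (u ∙ a))
least-multiplier a v []      _   = 0ℚ , ℚP.≤-refl , (λ ()) , inj₁ refl
least-multiplier a v (p ∷ P) pos with least-multiplier a v P (pos ∘ there) | divide (pos (here refl)) (p ∙ v)
... | t , 0≤t , ub , att | s , eq with ℚP.≤-total s t
... | inj₁ s≤t = t , 0≤t , ub′ , att′ att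
  where
  ub′ : ∀ {u} → u ∈ p ∷ P → u ∙ v ≤ t * (u ∙ a)
  ub′ (here refl) = subst (_≤ t * (p ∙ a)) eq
    (ℚP.*-monoʳ-≤-nonNeg (p ∙ a) {{ℚP.pos⇒nonNeg (p ∙ a) {{ℚ.positive (pos (here refl))}}}} s≤t)
  ub′ (there u∈)  = ub u∈
  att′ : _ → _
  att′ (inj₁ t≡0)          = inj₁ t≡0
  att′ (inj₂ (u , u∈ , e)) = inj₂ (u , there u∈ , e)
... | inj₂ t≤s = s , ℚP.≤-trans 0≤t t≤s , ub′ , inj₂ (p , here refl , sym eq)
  where
  ub′ : ∀ {u} → u ∈ p ∷ P → u ∙ v ≤ s * (u ∙ a)
  ub′ (here refl) = ℚP.≤-reflexive (sym eq)
  ub′ {u} (there u∈)  = ℚP.≤-trans (ub u∈)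
    (ℚP.*-monoʳ-≤-nonNeg (u ∙ a) {{ℚP.pos⇒nonNeg (u ∙ a) {{ℚ.positive (pos (there u∈))}}}} t≤s)

-- Fourier–Motzkin elimination of t from u ∙ v ≤ t (u ∙ a), u ∈ U, and 0 ≤ t.
module Eliminate {n} (a : Vec ℚ n) (U : List (Vec ℚ n)) where

  P N : List (Vec ℚ n)
  P = List.filter (λ u → 0ℚ ℚP.<? u ∙ a) U
  N = List.filter (λ u → u ∙ a ℚP.≤? 0ℚ) U

  P-pos : ∀ {u} → u ∈ P → 0ℚ < u ∙ a
  P-pos u∈ = proj₂ (∈-filter⁻ (λ u → 0ℚ ℚP.<? u ∙ a) {xs = U} u∈)

  P⊆U : ∀ {u} → u ∈ P → u ∈ U
  P⊆U u∈ = proj₁ (∈-filter⁻ (λ u → 0ℚ ℚP.<? u ∙ a) {xs = U} u∈)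

  N-nonPos : ∀ {u} → u ∈ N → u ∙ a ≤ 0ℚ
  N-nonPos u∈ = proj₂ (∈-filter⁻ (λ u → u ∙ a ℚP.≤? 0ℚ) {xs = U} u∈)

  N⊆U : ∀ {u} → u ∈ N → u ∈ U
  N⊆U u∈ = proj₁ (∈-filter⁻ (λ u → u ∙ a ℚP.≤? 0ℚ) {xs = U} u∈)

  -- For `u` in `P` and `u′` in `N`, the nonnegative combination whose pairing with `a` vanishes.
  cross : Vec ℚ n → Vec ℚ n → Vec ℚ n
  cross u u′ = ((u ∙ a) · u′) ⊕ ((- (u′ ∙ a)) · u)

  cross-∙ : ∀ u u′ v → cross u u′ ∙ v ≡ (u ∙ a) * (u′ ∙ v) + - (u′ ∙ a) * (u ∙ v)
  cross-∙ u u′ v = trans (∙-distribʳ-⊕ v ((u ∙ a) · u′) ((- (u′ ∙ a)) · u))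
    (cong₂ _+_ (∙-·ˡ (u ∙ a) u′ v) (∙-·ˡ (- (u′ ∙ a)) u v))

  -- Members of `P` bound `t` from below; members of `N` bound it from above or, when `u ∙ a` is
  -- zero, not at all. `cross` pairs these bounds, and `N` itself records the pairing with `0 ≤ t`.
  eliminated : List (Vec ℚ n)
  eliminated = N ++ List.cartesianProductWith cross P N

  eliminated-sound : ∀ v t → 0ℚ ≤ t → (∀ {u} → u ∈ U → u ∙ v ≤ t * (u ∙ a)) → InPolar eliminated v
  eliminated-sound v t 0≤t h {u} u∈ with ∈-++⁻ N u∈
  ... | inj₁ u∈N = gap≤⁻¹ (+-nonNeg (gap≤ (h (N⊆U u∈N))) (*-nonNeg 0≤t (gap≤ (N-nonPos u∈N))))
    (solve 3 (λ x t α → con 0ℚ := x :+ (t :* α :- x :+ t :* (con 0ℚ :- α))) refl (u ∙ v) t (u ∙ a))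
  ... | inj₂ u∈C with ∈-cartesianProductWith⁻ cross P N u∈C
  ... | p , q , p∈ , q∈ , refl = subst (_≤ 0ℚ) (sym (cross-∙ p q v))
    (gap≤⁻¹ (+-nonNeg (*-nonNeg (ℚP.<⇒≤ (P-pos p∈)) (gap≤ (h (N⊆U q∈))))
                      (*-nonNeg (gap≤ (N-nonPos q∈)) (gap≤ (h (P⊆U p∈)))))
      (solve 5 (λ α β x y t → con 0ℚ := α :* y :+ (:- β) :* x
                   :+ (α :* (t :* β :- y) :+ (con 0ℚ :- β) :* (t :* α :- x)))
        refl (p ∙ a) (q ∙ a) (p ∙ v) (q ∙ v) t))

  -- The least `t` meeting the bounds from `P` also works for `N`: if it is 0, because `N` is part
  -- of `eliminated`; if it is attained at `p`, by `cross p q` after division by `p ∙ a`. Minimality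
  -- later makes the local extension an attained minimum.
  eliminated-complete : ∀ v → InPolar eliminated v →
    Σ ℚ λ t → 0ℚ ≤ t × (∀ {u} → u ∈ U → u ∙ v ≤ t * (u ∙ a))
      × (∀ t′ → 0ℚ ≤ t′ → (∀ {u} → u ∈ U → u ∙ v ≤ t′ * (u ∙ a)) → t ≤ t′)
  eliminated-complete v h with least-multiplier a v P P-pos
  ... | t , 0≤t , ub , att = t , 0≤t , bound , least att
    where
    nonPos-case : ∀ {q} → q ∈ N → (t ≡ 0ℚ ⊎ Σ (Vec ℚ n) λ p → p ∈ P × p ∙ v ≡ t * (p ∙ a)) →
      q ∙ v ≤ t * (q ∙ a)
    nonPos-case {q} q∈ (inj₁ refl) = subst (q ∙ v ≤_) (sym (ℚP.*-zeroˡ (q ∙ a))) (h (∈-++⁺ˡ q∈))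
    nonPos-case {q} q∈ (inj₂ (p , p∈ , e)) =
      ℚP.*-cancelˡ-≤-pos (p ∙ a) {{ℚ.positive (P-pos p∈)}}
        (gap≤⁻¹ (gap≤ (subst (_≤ 0ℚ) (trans (cross-∙ p q v) (cong (λ x → (p ∙ a) * (q ∙ v) + - (q ∙ a) * x) e))
                        (h (∈-++⁺ʳ N (∈-cartesianProductWith⁺ cross p∈ q∈)))))
          (solve 4 (λ α β y t → α :* (t :* β) := α :* y :+ (con 0ℚ :- (α :* y :+ (:- β) :* (t :* α))))
            refl (p ∙ a) (q ∙ a) (q ∙ v) t))

    least : (t ≡ 0ℚ ⊎ Σ (Vec ℚ n) λ p → p ∈ P × p ∙ v ≡ t * (p ∙ a)) →
      ∀ t′ → 0ℚ ≤ t′ → (∀ {u} → u ∈ U → u ∙ v ≤ t′ * (u ∙ a)) → t ≤ t′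
    least (inj₁ refl)         t′ 0≤t′ _ = 0≤t′
    least (inj₂ (p , p∈ , e)) t′ _    k = ℚP.*-cancelʳ-≤-pos (p ∙ a) {{ℚ.positive (P-pos p∈)}}
      (subst (_≤ t′ * (p ∙ a)) e (k (P⊆U p∈)))

    bound : ∀ {u} → u ∈ U → u ∙ v ≤ t * (u ∙ a)
    bound {u} u∈ with 0ℚ ℚP.<? u ∙ a
    ... | yes 0<α = ub (∈-filter⁺ (λ u → 0ℚ ℚP.<? u ∙ a) u∈ 0<α)
    ... | no  0≮α = nonPos-case (∈-filter⁺ (λ u → u ∙ a ℚP.≤? 0ℚ) u∈ (ℚP.≮⇒≥ 0≮α)) att

open Eliminate using (eliminated; eliminated-sound; eliminated-complete)

-- Weyl's theorem: `v` lies in the cone of `a ∷ A` iff `v − t a` lies in that of `A` for some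
-- `t ≥ 0`, and eliminating `t` from the inequalities of `A` gives those of `a ∷ A`.
polar : List (Vec ℚ n) → List (Vec ℚ n)
polar {n} []      = axes n
polar     (a ∷ A) = eliminated a (polar A)

cone⇒polar : (A : List (Vec ℚ n)) {v : Vec ℚ n} → InCone A v → InPolar (polar A) v
cone⇒polar []      refl {u} _ = ℚP.≤-reflexive (∙-zeroʳ u)
cone⇒polar (a ∷ A) (t , 0≤t , w , w∈ , refl) = eliminated-sound a (polar A) _ t 0≤t λ {u} u∈ →
  subst (_≤ t * (u ∙ a))
    (sym (trans (∙-distribˡ-⊕ u (t · a) w) (cong (_+ u ∙ w) (∙-·ʳ t u a))))
    (gap≤⁻¹ (gap≤ (cone⇒polar A w∈ u∈))
      (solve 2 (λ x y → x := x :+ y :+ (con 0ℚ :- y)) refl (t * (u ∙ a)) (u ∙ w)))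

polar⇒cone : (A : List (Vec ℚ n)) {v : Vec ℚ n} → InPolar (polar A) v → InCone A v
polar⇒cone []      {v} h = polar-axes v h
polar⇒cone (a ∷ A) {v} h with eliminated-complete a (polar A) v h
... | t , 0≤t , ub , _ = t , 0≤t , v ⊕ ((- t) · a) , polar⇒cone A (λ {u} u∈ →
    subst (_≤ 0ℚ) (sym (trans (∙-distribˡ-⊕ u v ((- t) · a)) (cong (u ∙ v +_) (∙-·ʳ (- t) u a))))
      (gap≤⁻¹ (gap≤ (ub u∈))
        (solve 3 (λ x t α → con 0ℚ := x :+ (:- t) :* α :+ (t :* α :- x)) refl (u ∙ v) t (u ∙ a))))
  , restore t v a
  where
  restore : ∀ {n} t (v a : Vec ℚ n) → v ≡ (t · a) ⊕ (v ⊕ ((- t) · a))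
  restore t []      []      = refl
  restore t (b ∷ v) (c ∷ a) = cong₂ _∷_
    (solve 3 (λ t b c → b := t :* c :+ (b :+ (:- t) :* c)) refl t b c) (restore t v a)

-- The local convex extension

∣∣<⇒< : ∀ {p q} → ℚ.∣ p ∣ < q → p < q × - p < q
∣∣<⇒< {p} {q} lt with ℚP.∣p∣≡p∨∣p∣≡-p p
... | inj₁ e = p<q , ℚP.≤-<-trans (ℚP.≤-trans (ℚP.neg-antimono-≤ 0≤p) 0≤p) p<q
  where
  p<q = subst (_< q) e lt
  0≤p = subst (0ℚ ≤_) e (ℚP.0≤∣p∣ p)
... | inj₂ e = ℚP.≤-<-trans (ℚP.≤-trans p≤0 0≤-p) -p<q , -p<q
  where
  -p<q = subst (_< q) e lt
  0≤-p = subst (0ℚ ≤_) e (ℚP.0≤∣p∣ p)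
  p≤0 : p ≤ 0ℚ
  p≤0 = gap≤⁻¹ 0≤-p (solve 1 (λ p → con 0ℚ := p :+ :- p) refl p)

<⇒∣∣< : ∀ {p q} → p < q → - p < q → ℚ.∣ p ∣ < q
<⇒∣∣< {p} {q} lt lt′ with ℚP.∣p∣≡p∨∣p∣≡-p p
... | inj₁ e = subst (_< q) (sym e) lt
... | inj₂ e = subst (_< q) (sym e) lt′

*-↧ : ∀ a → a * ιℤ (ℚ.↧ a) ≡ ιℤ (ℚ.↥ a)
*-↧ a@(ℚ.mkℚ n d-1 _) = ℚP.toℚᵘ-injective (begin-equality
  ℚ.toℚᵘ (a * ιℤ (ℚ.↧ a))               ≃⟨ ℚP.toℚᵘ-homo-* a (ιℤ (ℚ.↧ a)) ⟩
  ℚ.toℚᵘ a ℚᵘ.* ℚ.toℚᵘ (ιℤ (ℚ.↧ a))     ≃⟨ ℚᵘP.*-congˡ {ℚ.toℚᵘ a} (ιℤ-toℚᵘ (ℚ.↧ a)) ⟩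
  ℚ.toℚᵘ a ℚᵘ.* ℚᵘ.mkℚᵘ (ℚ.↧ a) 0       ≃⟨ ℚᵘ.*≡* (trans (ℤP.*-identityʳ _)
       (cong (λ k → n ℤ.* k) (cong (λ j → ℤ.+ suc j) (sym (ℕP.*-identityʳ d-1))))) ⟩
  ℚᵘ.mkℚᵘ n 0                            ≃⟨ ιℤ-toℚᵘ n ⟨
  ℚ.toℚᵘ (ιℤ n)                          ∎)
  where open ℚᵘP.≤-Reasoning

0≤ιℤ : ∀ k → 0ℚ ≤ ιℤ (ℤ.+ k)
0≤ιℤ k = ιℤ-mono-≤ {ℤ.+ 0} {ℤ.+ k} (ℤ.+≤+ ℕ.z≤n)

0<ιℤ : ∀ k → 0ℚ < ιℤ (ℤ.+ suc k)
0<ιℤ k = ιℤ-mono-< {ℤ.+ 0} {ℤ.+ suc k} (ℤ.+<+ ℕ.z<s)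

0<↧ : ∀ a → 0ℚ < ιℤ (ℚ.↧ a)
0<↧ (ℚ.mkℚ _ d-1 _) = 0<ιℤ d-1

floor-spec : ∀ a → ιℤ (ℚ.floor a) ≤ a × a < ιℤ (ℚ.floor a) + 1ℚ
floor-spec a@(ℚ.mkℚ n d-1 _) =
    ℚP.*-cancelʳ-≤-pos δ {{ℚ.positive (0<↧ a)}} (gap≤⁻¹ (0≤ιℤ (n ℤD.% ℤ.+ suc d-1)) (trans eq (ℚP.+-comm (ιℤ r) (ιℤ b * δ))))
  , ℚP.*-cancelʳ-<-nonNeg δ {{ℚ.nonNegative (ℚP.<⇒≤ (0<↧ a))}} (gap<⁻¹
      (gap< (ιℤ-mono-< {r} {ℤ.+ suc d-1} (ℤ.+<+ (ℤD.n%d<d n (ℤ.+ suc d-1)))))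
      (trans (solve 3 (λ b δ r → (b :+ con 1ℚ) :* δ := r :+ b :* δ :+ (δ :- r)) refl (ιℤ b) δ (ιℤ r))
        (cong (_+ (δ - ιℤ r)) (sym eq))))
  where
  b = ℚ.floor a
  δ = ιℤ (ℚ.↧ a)
  r = ℤ.+ (n ℤD.% ℤ.+ suc d-1)
  eq : a * δ ≡ ιℤ r + ιℤ b * δ
  eq = begin
    a * δ                          ≡⟨ *-↧ a ⟩
    ιℤ n                           ≡⟨ cong ιℤ (ℤD.a≡a%n+[a/n]*n n (ℤ.+ suc d-1)) ⟩
    ιℤ (r ℤ.+ b ℤ.* ℚ.↧ a)        ≡⟨ ιℤ-+ r (b ℤ.* ℚ.↧ a) ⟩
    ιℤ r + ιℤ (b ℤ.* ℚ.↧ a)       ≡⟨ cong (λ x → ιℤ r + x) (ιℤ-* b (ℚ.↧ a)) ⟩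
    ιℤ r + ιℤ b * δ                ∎
    where open ≡-Reasoning

ιℤ-suc : ∀ c → ιℤ (ℤ.suc c) ≡ ιℤ c + 1ℚ
ιℤ-suc c = trans (ιℤ-+ (ℤ.+ 1) c) (ℚP.+-comm 1ℚ (ιℤ c))

ιℤ-<-suc : ∀ {a b} → ιℤ a < ιℤ b + 1ℚ → a ℤ.≤ b
ιℤ-<-suc {a} {b} lt = subst (a ℤ.≤_) (ℤP.pred-suc b)
  (ℤP.i<j⇒i≤pred[j] (ιℤ-cancel-< {a} {ℤ.suc b} (subst (ιℤ a <_) (sym (ιℤ-suc b)) lt)))

-- The floor is passed as `b` with its two bounds, because on a ray descending from an integer it
-- appears as the predecessor of that integer.
unit-gap : ∀ {a b c} → ιℤ b ≤ a → a < ιℤ b + 1ℚ → ℚ.∣ a - ιℤ c ∣ < 1ℚ → c ∈ (b ∷ ℤ.suc b ∷ [])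
unit-gap {a} {b} {c} b≤a a<b+1 lt with ∣∣<⇒< lt | b ℤP.≟ c
... | _             | yes b≡c = here (sym b≡c)
... | a-c<1 , c-a<1 | no  b≢c = there (here (ℤP.≤-antisym c≤1+b (ℤP.i<j⇒suc[i]≤j (ℤP.≤∧≢⇒< b≤c b≢c))))
  where
  c≤1+b : c ℤ.≤ ℤ.suc b
  c≤1+b = ιℤ-<-suc {c} {ℤ.suc b} (gap<⁻¹ (ℚP.+-mono-< (gap< a<b+1) (gap< c-a<1))
    (trans (cong (_+ 1ℚ) (ιℤ-suc b))
      (solve 3 (λ a b c → b :+ con 1ℚ :+ con 1ℚ := c :+ (b :+ con 1ℚ :- a :+ (con 1ℚ :- (:- (a :- c)))))
        refl a (ιℤ b) (ιℤ c))))
  b≤c : b ℤ.≤ c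
  b≤c = ιℤ-<-suc {b} {c} (gap<⁻¹ (ℚP.+-mono-≤-< (gap≤ b≤a) (gap< a-c<1))
    (solve 3 (λ a b c → c :+ con 1ℚ := b :+ (a :- b :+ (con 1ℚ :- (a :- c)))) refl a (ιℤ b) (ιℤ c)))

-- A finite superset of N(x): at an integral coordinate the successor is at distance one, hence
-- outside N(x), so `support` filters by `InN?`.
around : Vec ℚ n → List (Vec ℤ n)
around []      = [] ∷ []
around (a ∷ x) = List.cartesianProductWith _∷_ (ℚ.floor a ∷ ℤ.suc (ℚ.floor a) ∷ []) (around x)

InN⇒∈around : {x : Vec ℚ n} {z : Vec ℤ n} → InN x z → z ∈ around x
InN⇒∈around []                 = here refl
InN⇒∈around (_∷_ {a = a} lt r) = ∈-cartesianProductWith⁺ _∷_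
  (unit-gap (proj₁ (floor-spec a)) (proj₂ (floor-spec a)) lt) (InN⇒∈around r)

InN? : (x : Vec ℚ n) (z : Vec ℤ n) → Dec (InN x z)
InN? []      []      = yes []
InN? (a ∷ x) (c ∷ z) = map′ (λ (p , q) → p ∷ q) (λ { (p ∷ q) → p , q })
  ((ℚ.∣ a - ιℤ c ∣ ℚP.<? 1ℚ) ×-dec InN? x z)

InN-ιv : (z : Vec ℤ n) → InN (ιv z) z
InN-ιv []      = []
InN-ιv (c ∷ z) = <⇒∣∣<
  (gap<⁻¹ {d = 1ℚ} (0<ιℤ 0) (solve 1 (λ c → con 1ℚ := c :- c :+ con 1ℚ) refl (ιℤ c)))
  (gap<⁻¹ {d = 1ℚ} (0<ιℤ 0) (solve 1 (λ c → con 1ℚ := :- (c :- c) :+ con 1ℚ) refl (ιℤ c)))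
  ∷ InN-ιv z

-- Weighted families of points and the cone of their columns

module _ (f : Vec ℤ n → ℤ∞) where

  entry : Vec ℤ n → ℤ∞ → List (Vec ℤ n × ℤ)
  entry y (fin a) = (y , a) ∷ []
  entry y +∞      = []

  graph : List (Vec ℤ n) → List (Vec ℤ n × ℤ)
  graph = List.concatMap (λ y → entry y (f y))

  ∈-graph⁺ : ∀ {ys y a} → y ∈ ys → f y ≡ fin a → (y , a) ∈ graph ys
  ∈-graph⁺ {y = y} y∈ eq = ∈-concatMap⁺ (λ y → entry y (f y))
    (Any.map (λ { refl → subst (λ v → (y , _) ∈ entry y v) (sym eq) (here refl) }) y∈)

  ∈-graph⁻ : ∀ ys {y a} → (y , a) ∈ graph ys → y ∈ ys × f y ≡ fin a
  ∈-graph⁻ (z ∷ ys) p∈ with f z in eq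
  ∈-graph⁻ (z ∷ ys) (here refl) | fin b = here refl , eq
  ∈-graph⁻ (z ∷ ys) (there p∈)  | fin b = let y∈ , e = ∈-graph⁻ ys p∈ in there y∈ , e
  ∈-graph⁻ (z ∷ ys) p∈          | +∞    = let y∈ , e = ∈-graph⁻ ys p∈ in there y∈ , e

vsum : List (Term n) → Vec ℚ n
vsum {n} = List.foldr (λ t acc → (weight t · ιv (pt t)) ⊕ acc) (zeroV n)

wsum : List (Term n) → ℚ
wsum = List.foldr (λ t acc → weight t + acc) 0ℚ

affine-bound : (c : ℚ) (P : Vec ℚ n) (ts : List (Term n)) →
  All (λ t → 0ℚ < weight t × c + P ∙ ιv (pt t) ≤ ιℤ (value t)) ts →
  c * wsum ts + P ∙ vsum ts ≤ cost ts
affine-bound c P []       []               =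
  ℚP.≤-reflexive (trans (cong₂ _+_ (ℚP.*-zeroʳ c) (∙-zeroʳ P)) refl)
affine-bound c P (t ∷ ts) ((0<w , le) ∷ h) = gap≤⁻¹
  (+-nonNeg (*-nonNeg (ℚP.<⇒≤ 0<w) (gap≤ le)) (gap≤ (affine-bound c P ts h)))
  (trans
    (solve 7 (λ c w W v C p q → w :* v :+ C := c :* (w :+ W) :+ (w :* p :+ q)
        :+ (w :* (v :- (c :+ p)) :+ (C :- (c :* W :+ q)))) refl
      c (weight t) (wsum ts) (ιℤ (value t)) (cost ts) (P ∙ ιv (pt t)) (P ∙ vsum ts))
    (cong (λ x → c * (weight t + wsum ts) + x + (weight t * (ιℤ (value t) - (c + P ∙ ιv (pt t)))
                   + (cost ts - (c * wsum ts + P ∙ vsum ts))))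
      (sym (trans (∙-distribˡ-⊕ P (weight t · ιv (pt t)) (vsum ts))
        (cong (_+ P ∙ vsum ts) (∙-·ʳ (weight t) P (ιv (pt t))))))))

-- Weak duality of the linear program behind the local extension. It serves for the crude bound
-- `L≤cost` and, later, to carry subgradient inequalities from N(x) to x.
feasible-bound : ∀ {f : Vec ℤ n → ℤ∞} {x ts} (c : ℚ) (P : Vec ℚ n) → Feasible f x ts →
  (∀ {y a} → InN x y → f y ≡ fin a → c + P ∙ ιv y ≤ ιℤ a) → c + P ∙ x ≤ cost ts
feasible-bound {x = x} {ts} c P (h , vs , ws) le = subst (_≤ cost ts)
  (cong₂ _+_ (trans (cong (c *_) ws) (ℚP.*-identityʳ c)) (cong (P ∙_) vs))
  (affine-bound c P ts (All.map (λ (y∈N , 0<w , eq) → 0<w , le y∈N eq) h))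

cone-zero : (A : List (Vec ℚ n)) → InCone A (zeroV n)
cone-zero []      = refl
cone-zero (a ∷ A) = 0ℚ , ℚP.≤-refl , zeroV _ , cone-zero A ,
  sym (trans (cong (_⊕ zeroV _) (·-zeroˡ a)) (⊕-identityˡ (zeroV _)))

cone-add : ∀ {A : List (Vec ℚ n)} {a v t} → a ∈ A → 0ℚ ≤ t → InCone A v → InCone A ((t · a) ⊕ v)
cone-add {a = a} {t = t} (here refl) 0≤t (s , 0≤s , w , w∈ , refl) =
  t + s , +-nonNeg 0≤t 0≤s , w , w∈ ,
  sym (trans (cong (_⊕ w) (·-distribʳ t s a)) (⊕-assoc (t · a) (s · a) w))
cone-add {a = a} {t = t} (there {x = b} a∈) 0≤t (s , 0≤s , w , w∈ , refl) =
  s , 0≤s , (t · a) ⊕ w , cone-add a∈ 0≤t w∈ ,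
  trans (sym (⊕-assoc (t · a) (s · b) w))
    (trans (cong (_⊕ w) (⊕-comm (t · a) (s · b))) (⊕-assoc (s · b) (t · a) w))

column : Vec ℤ n × ℤ → Vec ℚ (2 ℕ.+ n)
column (y , a) = ιℤ a ∷ 1ℚ ∷ ιv y

terms⇒cone : (G : List (Vec ℤ n × ℤ)) (ts : List (Term n)) →
  All (λ t → 0ℚ < weight t × (pt t , value t) ∈ G) ts →
  InCone (List.map column G) (cost ts ∷ wsum ts ∷ vsum ts)
terms⇒cone G []       []               = cone-zero (List.map column G)
terms⇒cone G (t ∷ ts) ((0<w , t∈) ∷ h) = subst
  (λ w → InCone (List.map column G) (cost (t ∷ ts) ∷ w + wsum ts ∷ vsum (t ∷ ts)))
  (ℚP.*-identityʳ (weight t))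
  (cone-add (∈-map⁺ column t∈) (ℚP.<⇒≤ 0<w) (terms⇒cone G ts h))

cone⇒terms : (G : List (Vec ℤ n × ℤ)) {c s : ℚ} {z : Vec ℚ n} →
  InCone (List.map column G) (c ∷ s ∷ z) →
  Σ (List (Term n)) λ ts → All (λ t → 0ℚ < weight t × (pt t , value t) ∈ G) ts
    × cost ts ≡ c × wsum ts ≡ s × vsum ts ≡ z
cone⇒terms []            refl = [] , [] , refl , refl , refl
cone⇒terms ((y , a) ∷ G) (t , 0≤t , (c ∷ s ∷ z) , w∈ , refl) with cone⇒terms G w∈ | 0ℚ ℚP.<? t
... | ts , h , refl , refl , refl | yes 0<t =
  term y t a ∷ ts , (0<t , here refl) ∷ All.map (λ (p , q) → p , there q) h ,
  refl , cong (_+ wsum ts) (sym (ℚP.*-identityʳ t)) , refl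
-- `Feasible` allows positive weights only, so a generator with multiplier zero is dropped.
... | ts , h , refl , refl , refl | no 0≮t rewrite ℚP.≤-antisym (ℚP.≮⇒≥ 0≮t) 0≤t =
  ts , All.map (λ (p , q) → p , there q) h ,
  solve 2 (λ a c → c := con 0ℚ :* a :+ c) refl (ιℤ a) (cost ts) ,
  solve 1 (λ s → s := con 0ℚ :* con 1ℚ :+ s) refl (wsum ts) ,
  sym (trans (cong (_⊕ vsum ts) (·-zeroˡ (ιv y))) (⊕-identityˡ (vsum ts)))

-- The elimination treats a nonnegative unknown; measuring costs from `L` makes the excess one.
lower-bound : (G : List (Vec ℤ n × ℤ)) → Σ ℚ λ L → ∀ {y a} → (y , a) ∈ G → L ≤ ιℤ a
lower-bound []            = 0ℚ , λ ()
lower-bound ((y , a) ∷ G) with lower-bound G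
... | L , lb = ιℤ a ℚ.⊓ L ,
  λ { (here refl) → ℚP.p⊓q≤p (ιℤ a) L ; (there p) → ℚP.≤-trans (ℚP.p⊓q≤q (ιℤ a) L) (lb p) }

-- A family of cost c is feasible at x exactly when (c, 1, x) lies in the cone of the columns
-- (value, 1, point). With c = L + t, the condition on t is the one eliminated above, for the base
-- (L, 1, x) and the direction down; so the least t is the one found by the elimination.
module LocalExtension (f : Vec ℤ n → ℤ∞) (x : Vec ℚ n) where

  support : List (Vec ℤ n × ℤ)
  support = graph f (List.filter (InN? x) (around x))

  columns : List (Vec ℚ (2 ℕ.+ n))
  columns = List.map column support

  feasible⇒cone : ∀ {ts} → Feasible f x ts → InCone columns (cost ts ∷ 1ℚ ∷ x)
  feasible⇒cone {ts} (h , vs , ws) = subst₂ (λ w v → InCone columns (cost ts ∷ w ∷ v)) ws vs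
    (terms⇒cone support ts (All.map (λ (y∈N , 0<w , eq) →
      0<w , ∈-graph⁺ f (∈-filter⁺ (InN? x) (InN⇒∈around y∈N) y∈N) eq) h))

  cone⇒feasible : ∀ {c} → InCone columns (c ∷ 1ℚ ∷ x) → Σ (List (Term n)) λ ts → Feasible f x ts × cost ts ≡ c
  cone⇒feasible v∈ with cone⇒terms support v∈
  ... | ts , h , cs , ws , vs = ts , (All.map (λ (0<w , t∈) →
      let y∈ , eq = ∈-graph⁻ f _ t∈ in proj₂ (∈-filter⁻ (InN? x) {xs = around x} y∈) , 0<w , eq) h , vs , ws) , cs

  L : ℚ
  L = proj₁ (lower-bound support)

  L≤cost : ∀ {ts} → Feasible f x ts → L ≤ cost ts
  L≤cost {ts} fe = subst (_≤ cost ts)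
    (trans (cong (λ y → L + y) (∙-zeroˡ x)) (ℚP.+-identityʳ L))
    (feasible-bound L (zeroV n) fe λ {y} {a} y∈N eq →
      subst (_≤ ιℤ a) (sym (trans (cong (λ q → L + q) (∙-zeroˡ (ιv y))) (ℚP.+-identityʳ L)))
        (proj₂ (lower-bound support) (∈-graph⁺ f (∈-filter⁺ (InN? x) (InN⇒∈around y∈N) y∈N) eq)))

  down base : Vec ℚ (2 ℕ.+ n)
  down = - 1ℚ ∷ zeroV (suc n)
  base = L ∷ 1ℚ ∷ x

  shift-∙ : ∀ u c → u ∙ (c ∷ 1ℚ ∷ x) ≡ u ∙ base - (c - L) * (u ∙ down)
  shift-∙ (u₀ ∷ u) c = trans
    (solve 4 (λ u₀ c L y → u₀ :* c :+ y := u₀ :* L :+ y :- (c :- L) :* (u₀ :* (:- con 1ℚ) :+ con 0ℚ)) refl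
      u₀ c L (u ∙ (1ℚ ∷ x)))
    (cong (λ z → u₀ * L + u ∙ (1ℚ ∷ x) - (c - L) * (u₀ * - 1ℚ + z)) (sym (∙-zeroʳ u)))

  cost-cond : ∀ c → InPolar (polar columns) (c ∷ 1ℚ ∷ x) →
    ∀ {u} → u ∈ polar columns → u ∙ base ≤ (c - L) * (u ∙ down)
  cost-cond c h {u} u∈ = gap≤⁻¹ (gap≤ (h u∈))
    (trans (solve 2 (λ p q → q := p :+ (con 0ℚ :- (p :- q))) refl (u ∙ base) ((c - L) * (u ∙ down)))
      (cong (λ z → u ∙ base + (0ℚ - z)) (sym (shift-∙ u c))))

  cost-cond⁻¹ : ∀ c → (∀ {u} → u ∈ polar columns → u ∙ base ≤ (c - L) * (u ∙ down)) →
    InPolar (polar columns) (c ∷ 1ℚ ∷ x)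
  cost-cond⁻¹ c h {u} u∈ = gap≤⁻¹ (gap≤ (h u∈))
    (trans (solve 2 (λ p q → con 0ℚ := p :- q :+ (q :- p)) refl (u ∙ base) ((c - L) * (u ∙ down)))
      (cong (_+ ((c - L) * (u ∙ down) - u ∙ base)) (sym (shift-∙ u c))))

  feasible-cond : ∀ {ts} → Feasible f x ts →
    ∀ {u} → u ∈ polar columns → u ∙ base ≤ (cost ts - L) * (u ∙ down)
  feasible-cond {ts} fe = cost-cond (cost ts) (cone⇒polar columns (feasible⇒cone fe))

  locExt : Σ ℚ∞ (IsLocExt f x)
  -- `eliminated` is a finite list, so it is decidable whether some family is feasible; if so,
  -- completeness of the elimination returns the least excess over `L`.
  locExt with All.all? (λ u → u ∙ base ℚP.≤? 0ℚ) (eliminated down (polar columns))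
  ... | no ¬h = +∞q , λ ts fe → ¬h (All.tabulate
      (eliminated-sound down (polar columns) base (cost ts - L) (gap≤ (L≤cost fe)) (feasible-cond fe)))
  ... | yes h with eliminated-complete down (polar columns) base (All.lookup h)
  ... | t , 0≤t , ub , least = finq (L + t) , cone⇒feasible (polar⇒cone columns (cost-cond⁻¹ (L + t) λ {u} u∈ →
        subst (λ s → u ∙ base ≤ s * (u ∙ down)) (solve 2 (λ L t → t := L :+ t :- L) refl L t) (ub u∈)))
      , λ ts fe → gap≤⁻¹ (gap≤ (least (cost ts - L) (gap≤ (L≤cost fe)) (feasible-cond fe)))
          (solve 3 (λ c L t → c := L :+ t :+ (c :- L :- t)) refl (cost ts) L t)

open LocalExtension using (locExt)

-- `IntegrallyConvex` speaks about given values of the local extension. `locExt` supplies them at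
-- all three points, and a family attaining the value at the combination is returned.
feasible-convex : ∀ {f : Vec ℤ n → ℤ∞} {x y ts us} → IntegrallyConvex f → Feasible f x ts → Feasible f y us →
  ∀ {t} → 0ℚ < t → t < 1ℚ → Σ (List (Term n)) λ vs →
    Feasible f ((t · x) ⊕ ((1ℚ - t) · y)) vs × cost vs ≤ t * cost ts + (1ℚ - t) * cost us
feasible-convex {f = f} {x} {y} {ts} {us} ic fx fy {t} 0<t t<1
  with locExt f x | locExt f y | locExt f ((t · x) ⊕ ((1ℚ - t) · y))
... | +∞q    , ex | _           | _ = ⊥-elim (ex ts fx)
... | finq _ , _  | +∞q    , ey | _ = ⊥-elim (ey us fy)
... | finq p , ex | finq q , ey | v , ez with v | ez | ic x y t (finq p) (finq q) v 0<t t<1 ex ey ez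
-- Both end values are finite, so the inequality excludes `v = +∞q`.
... | finq r | (vs , fe , refl) , _ | fin≤ le = vs , fe , ℚP.≤-trans le
  (ℚP.+-mono-≤ (ℚP.*-monoˡ-≤-nonNeg t {{ℚ.nonNegative (ℚP.<⇒≤ 0<t)}} (proj₂ ex ts fx))
    (ℚP.*-monoˡ-≤-nonNeg (1ℚ - t) {{ℚ.nonNegative (ℚP.<⇒≤ (gap< t<1))}} (proj₂ ey us fy)))

feasible-singleton : ∀ {f : Vec ℤ n → ℤ∞} {y a} → f y ≡ fin a → Feasible f (ιv y) (term y 1ℚ a ∷ [])
feasible-singleton {y = y} eq = (InN-ιv y , 0<ιℤ 0 , eq) ∷ []
  , trans (cong (_⊕ zeroV _) (·-identityˡ (ιv y))) (trans (⊕-comm (ιv y) (zeroV _)) (⊕-identityˡ (ιv y)))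
  , refl

feasible-segment : ∀ {f : Vec ℤ n → ℤ∞} {y z a b} → IntegrallyConvex f → f y ≡ fin a → f z ≡ fin b →
  ∀ {t} → 0ℚ < t → t < 1ℚ → Σ (List (Term n)) λ vs →
    Feasible f ((t · ιv y) ⊕ ((1ℚ - t) · ιv z)) vs × cost vs ≤ t * ιℤ a + (1ℚ - t) * ιℤ b
feasible-segment {a = a} {b} ic fy fz {t} 0<t t<1
  with feasible-convex ic (feasible-singleton fy) (feasible-singleton fz) 0<t t<1
... | vs , fe , le = vs , fe , subst (cost vs ≤_)
  (solve 3 (λ t a b → t :* (con 1ℚ :* a :+ con 0ℚ) :+ (con 1ℚ :- t) :* (con 1ℚ :* b :+ con 0ℚ)
      := t :* a :+ (con 1ℚ :- t) :* b) refl t (ιℤ a) (ιℤ b)) le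

-- Subgradients

gapℤ≤⁻¹ : ∀ {i j d} → ℤ.+ 0 ℤ.≤ d → j ≡ i ℤ.+ d → i ℤ.≤ j
gapℤ≤⁻¹ {i} {d = d} 0≤d refl = subst (ℤ._≤ i ℤ.+ d) (ℤP.+-identityʳ i) (ℤP.+-monoʳ-≤ i 0≤d)

-- A value below all upper bounds is raised to each lower bound in turn, which the hypothesis keeps
-- below the upper bounds. The bounds are integers, hence so is the value: this makes the
-- subgradient integral.
separate : {A B : Set} (l : A → ℤ) (u : B → ℤ) (as : List A) (bs : List B) →
  (∀ {a b} → a ∈ as → b ∈ bs → l a ℤ.≤ u b) →
  Σ ℤ λ q → (∀ {a} → a ∈ as → l a ℤ.≤ q) × (∀ {b} → b ∈ bs → q ℤ.≤ u b)
separate l u []       []       _ = ℤ.+ 0 , (λ ()) , (λ ())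
separate l u []       (b ∷ bs) h with separate l u [] bs (λ ())
... | q , _ , ub = q ℤ.⊓ u b , (λ ()) , λ
  { (here refl) → ℤP.i⊓j≤j q (u b) ; (there b∈) → ℤP.≤-trans (ℤP.i⊓j≤i q (u b)) (ub b∈) }
separate l u (a ∷ as) bs       h with separate l u as bs (λ a∈ → h (there a∈))
... | q , lb , ub = q ℤ.⊔ l a
  , (λ { (here refl) → ℤP.i≤j⊔i q (l a) ; (there a∈) → ℤP.≤-trans (lb a∈) (ℤP.i≤i⊔j q (l a)) })
  , λ b∈ → ℤP.⊔-lub (ub b∈) (h (here refl) b∈)

interval : ℤ → List ℤ
interval c = c ∷ ℤ.suc c ∷ ℤ.pred c ∷ []

neighbours : Vec ℤ n → List (Vec ℤ n)
neighbours []      = [] ∷ []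
neighbours (c ∷ x) = List.cartesianProductWith _∷_ (interval c) (neighbours x)

self∈neighbours : (x : Vec ℤ n) → x ∈ neighbours x
self∈neighbours []      = here refl
self∈neighbours (c ∷ x) = ∈-cartesianProductWith⁺ _∷_ {xs = interval c} (here refl) (self∈neighbours x)

within-one : ∀ {b c} → b ℤ.≤ ℤ.suc c → c ℤ.≤ ℤ.suc b → c ∈ interval b
within-one {b} {c} b≤1+c c≤1+b with ℤP.<-cmp b c
... | tri≈ _ refl _ = here refl
... | tri< b<c _ _  = there (here (ℤP.≤-antisym c≤1+b (ℤP.i<j⇒suc[i]≤j b<c)))
... | tri> _ _ c<b  = there (there (here (ℤP.≤-antisym (ℤP.i<j⇒i≤pred[j] c<b)
      (subst (ℤ.pred b ℤ.≤_) (ℤP.pred-suc c) (ℤP.pred-mono b≤1+c)))))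

data Within : Vec ℚ n → Vec ℤ n → Set where
  []  : Within [] []
  _∷_ : ∀ {a c} {z : Vec ℚ n} {x : Vec ℤ n} →
        (ιℤ c - 1ℚ ≤ a × a ≤ ιℤ c + 1ℚ) → Within z x → Within (a ∷ z) (c ∷ x)

-- The box of `Within` is closed, but N(z) asks for distance less than one, so coordinates of `y`
-- and `x` differ by less than two, hence by at most one.
within-InN⇒neighbour : {z : Vec ℚ n} {x y : Vec ℤ n} → Within z x → InN z y → y ∈ neighbours x
within-InN⇒neighbour []                                [] = here refl
within-InN⇒neighbour (_∷_ {a = a} {c} (lo , hi) wi) (_∷_ {c = d} lt y∈N) with ∣∣<⇒< lt
... | a-d<1 , d-a<1 = ∈-cartesianProductWith⁺ _∷_
  (within-one
    (ιℤ-<-suc {c} {ℤ.suc d} (gap<⁻¹ (ℚP.+-mono-≤-< (gap≤ lo) (gap< a-d<1))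
      (trans (cong (_+ 1ℚ) (ιℤ-suc d))
        (solve 3 (λ a c d → d :+ con 1ℚ :+ con 1ℚ := c :+ (a :- (c :- con 1ℚ) :+ (con 1ℚ :- (a :- d))))
          refl a (ιℤ c) (ιℤ d)))))
    (ιℤ-<-suc {d} {ℤ.suc c} (gap<⁻¹ (ℚP.+-mono-≤-< (gap≤ hi) (gap< d-a<1))
      (trans (cong (_+ 1ℚ) (ιℤ-suc c))
        (solve 3 (λ a c d → c :+ con 1ℚ :+ con 1ℚ := d :+ (c :+ con 1ℚ :- a :+ (con 1ℚ :- (:- (a :- d)))))
          refl a (ιℤ c) (ιℤ d))))))
  (within-InN⇒neighbour wi y∈N)

near-ι : ∀ {b c} → c ∈ interval b → ιℤ b - 1ℚ ≤ ιℤ c × ιℤ c ≤ ιℤ b + 1ℚ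
near-ι {b} (here refl) =
    gap≤⁻¹ (0≤ιℤ 1) (solve 1 (λ b → b := b :- con 1ℚ :+ con 1ℚ) refl (ιℤ b))
  , gap≤⁻¹ (0≤ιℤ 1) refl
near-ι {b} (there (here refl)) rewrite ιℤ-suc b =
    gap≤⁻¹ (+-nonNeg (0≤ιℤ 1) (0≤ιℤ 1)) (solve 1 (λ b → b :+ con 1ℚ := b :- con 1ℚ :+ (con 1ℚ :+ con 1ℚ)) refl (ιℤ b))
  , ℚP.≤-refl
near-ι {b} (there (there (here refl))) rewrite ιℤ-+ ℤ.-[1+ 0 ] b =
    ℚP.≤-reflexive (ℚP.+-comm (ιℤ b) (- 1ℚ))
  , gap≤⁻¹ (+-nonNeg (0≤ιℤ 1) (0≤ιℤ 1)) (solve 1 (λ b → b :+ con 1ℚ := :- con 1ℚ :+ b :+ (con 1ℚ :+ con 1ℚ)) refl (ιℤ b))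

convex-between : ∀ {l u p q t} → 0ℚ ≤ t → 0ℚ ≤ 1ℚ - t → l ≤ p × p ≤ u → l ≤ q × q ≤ u →
  l ≤ t * p + (1ℚ - t) * q × t * p + (1ℚ - t) * q ≤ u
convex-between {l} {u} {p} {q} {t} 0≤t 0≤1-t (l≤p , p≤u) (l≤q , q≤u) =
    gap≤⁻¹ (+-nonNeg (*-nonNeg 0≤t (gap≤ l≤p)) (*-nonNeg 0≤1-t (gap≤ l≤q)))
      (solve 4 (λ l p q t → t :* p :+ (con 1ℚ :- t) :* q
        := l :+ (t :* (p :- l) :+ (con 1ℚ :- t) :* (q :- l))) refl l p q t)
  , gap≤⁻¹ (+-nonNeg (*-nonNeg 0≤t (gap≤ p≤u)) (*-nonNeg 0≤1-t (gap≤ q≤u)))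
      (solve 4 (λ u p q t → u := t :* p :+ (con 1ℚ :- t) :* q
        :+ (t :* (u :- p) :+ (con 1ℚ :- t) :* (u :- q))) refl u p q t)

within-convex : ∀ {t} → 0ℚ ≤ t → 0ℚ ≤ 1ℚ - t → (x : Vec ℤ n) {y z : Vec ℤ n} →
  y ∈ neighbours x → z ∈ neighbours x → Within ((t · ιv y) ⊕ ((1ℚ - t) · ιv z)) x
within-convex 0≤t 0≤1-t []      {[]} {[]} _ _ = []
within-convex 0≤t 0≤1-t (c ∷ x) y∈ z∈
  with ∈-cartesianProductWith⁻ _∷_ (interval c) (neighbours x) y∈
     | ∈-cartesianProductWith⁻ _∷_ (interval c) (neighbours x) z∈
... | _ , _ , b∈ , y∈′ , refl | _ , _ , d∈ , z∈′ , refl =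
  convex-between 0≤t 0≤1-t (near-ι b∈) (near-ι d∈) ∷ within-convex 0≤t 0≤1-t x y∈′ z∈′

-- The part of integral convexity that the induction on the dimension consumes; it passes to slices
-- `f (c ∷ _)`.
MidpointConvex : (Vec ℤ n → ℤ∞) → Set
MidpointConvex {n} f = ∀ {y z a b} → f y ≡ fin a → f z ≡ fin b → Σ (List (Term n)) λ vs →
  Feasible f ((ℚ.½ · ιv y) ⊕ ((1ℚ - ℚ.½) · ιv z)) vs × cost vs ≤ ℚ.½ * ιℤ a + (1ℚ - ℚ.½) * ιℤ b

integrallyConvex⇒midpointConvex : {f : Vec ℤ n → ℤ∞} → IntegrallyConvex f → MidpointConvex f
integrallyConvex⇒midpointConvex ic fy fz = feasible-segment ic fy fz (0<½) ½<1
  where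
  0<½ : 0ℚ < ℚ.½
  0<½ = ℚP.positive⁻¹ ℚ.½
  ½<1 : ℚ.½ < 1ℚ
  ½<1 = gap<⁻¹ 0<½ refl

InN-integer-head : ∀ {c d} {z : Vec ℚ n} {y : Vec ℤ n} → InN (ιℤ c ∷ z) (d ∷ y) → d ≡ c
InN-integer-head {c = c} {d} (lt ∷ _) with ∣∣<⇒< lt
... | c-d<1 , d-c<1 = ℤP.≤-antisym
  (ιℤ-<-suc {d} {c} (gap<⁻¹ (gap< d-c<1)
    (solve 2 (λ c d → c :+ con 1ℚ := d :+ (con 1ℚ :- (:- (c :- d)))) refl (ιℤ c) (ιℤ d))))
  (ιℤ-<-suc {c} {d} (gap<⁻¹ (gap< c-d<1)
    (solve 2 (λ c d → d :+ con 1ℚ := c :+ (con 1ℚ :- (c :- d))) refl (ιℤ c) (ιℤ d))))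

-- Over an integral first coordinate `c`, every point of N has first coordinate `c`, so it can be
-- deleted from the whole family.
feasible-slice : ∀ {f : Vec ℤ (suc n) → ℤ∞} {c z vs} → Feasible f (ιℤ c ∷ z) vs →
  Σ (List (Term n)) λ us → Feasible (λ y → f (c ∷ y)) z us × cost us ≡ cost vs
feasible-slice {n} {f} {c} {z} {vs} (h , vs≡ , ws≡) with go vs h
  where
  go : ∀ vs → All (λ t → InN (ιℤ c ∷ z) (pt t) × 0ℚ < weight t × f (pt t) ≡ fin (value t)) vs →
    Σ (List (Term n)) λ us →
      All (λ t → InN z (pt t) × 0ℚ < weight t × f (c ∷ pt t) ≡ fin (value t)) us
      × vsum us ≡ Vec.tail (vsum vs) × wsum us ≡ wsum vs × cost us ≡ cost vs
  go [] [] = [] , [] , refl , refl , refl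
  go (term (d ∷ y) w a ∷ vs) ((y∈N , 0<w , eq) ∷ h) with InN-integer-head {c = c} y∈N | y∈N | go vs h
  ... | refl | _ ∷ y∈N′ | us , k , v≡ , w≡ , c≡ =
    term y w a ∷ us , (y∈N′ , 0<w , eq) ∷ k ,
    trans (cong ((w · ιv y) ⊕_) v≡) (tail-⊕ (w · ιv (d ∷ y)) (vsum vs)) ,
    cong (λ q → w + q) w≡ , cong (λ q → w * ιℤ a + q) c≡
    where
    tail-⊕ : ∀ {n} (u v : Vec ℚ (suc n)) → Vec.tail u ⊕ Vec.tail v ≡ Vec.tail (u ⊕ v)
    tail-⊕ (_ ∷ _) (_ ∷ _) = refl
... | us , k , v≡ , w≡ , c≡ = us , (k , trans v≡ (cong Vec.tail vs≡) , trans w≡ ws≡) , c≡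

midpoint-slice : {f : Vec ℤ (suc n) → ℤ∞} → MidpointConvex f → ∀ c → MidpointConvex (λ y → f (c ∷ y))
midpoint-slice {f = f} mc c {y} {z} fy fz with mc fy fz
... | vs , fe , le with feasible-slice (subst (λ a → Feasible f (a ∷ ((ℚ.½ · ιv y) ⊕ ((1ℚ - ℚ.½) · ιv z))) vs)
      (solve 2 (λ h c → h :* c :+ (con 1ℚ :- h) :* c := c) refl ℚ.½ (ιℤ c)) fe)
... | us , fe′ , eq = us , fe′ , subst (_≤ _) (sym eq) le

ι-⟨⟩ : (p y : Vec ℤ n) → ιℤ ⟨ p , y ⟩ ≡ ιv p ∙ ιv y
ι-⟨⟩ []      []      = refl
ι-⟨⟩ (a ∷ p) (b ∷ y) = trans (ιℤ-+ (a ℤ.* b) ⟨ p , y ⟩) (cong₂ _+_ (ιℤ-* a b) (ι-⟨⟩ p y))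

ι-⟨⟩- : (p y : Vec ℤ n) (b : ℤ) → ιℤ (⟨ p , y ⟩ ℤ.- b) ≡ ιv p ∙ ιv y - ιℤ b
ι-⟨⟩- p y b = trans (ιℤ-- ⟨ p , y ⟩ b) (cong (_- ιℤ b) (ι-⟨⟩ p y))

-- Written as a bound on the terms of the conjugate at `p`. The number `a` is not tied to `f x`:
-- with `f x` infinite, the condition for all `y` says that the affine function of slope `p` and
-- value `a` at `x` minorizes `f`.
Subgradient : (Vec ℤ n → ℤ∞) → Vec ℤ n → ℤ → Vec ℤ n → Vec ℤ n → Set
Subgradient f x a p y = ∀ {b} → f y ≡ fin b → ⟨ p , y ⟩ ℤ.- b ℤ.≤ ⟨ p , x ⟩ ℤ.- a

subgradient-ι : ∀ {f : Vec ℤ n → ℤ∞} {x a p y b} → Subgradient f x a p y → f y ≡ fin b →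
  ιℤ a - ιv p ∙ ιv x + ιv p ∙ ιv y ≤ ιℤ b
subgradient-ι {x = x} {a} {p} {y} {b} h fy = gap≤⁻¹
  (gap≤ (subst₂ _≤_ (ι-⟨⟩- p y b) (ι-⟨⟩- p x a) (ιℤ-mono-≤ {⟨ p , y ⟩ ℤ.- b} {⟨ p , x ⟩ ℤ.- a} (h fy))))
  (solve 4 (λ a b X Y → b := a :- X :+ Y :+ (X :- a :- (Y :- b))) refl
    (ιℤ a) (ιℤ b) (ιv p ∙ ιv x) (ιv p ∙ ιv y))

1-½≡½ : 1ℚ - ℚ.½ ≡ ℚ.½
1-½≡½ = refl

½+½≡1 : ℚ.½ + ℚ.½ ≡ 1ℚ
½+½≡1 = refl

half-sum : ∀ p q → ℚ.½ * p + (1ℚ - ℚ.½) * q + (ℚ.½ * p + (1ℚ - ℚ.½) * q) ≡ p + q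
half-sum p q = trans (cong (λ k → ℚ.½ * p + k * q + (ℚ.½ * p + k * q)) 1-½≡½)
  (trans (regroup ℚ.½ p q) (trans (cong (_* (p + q)) ½+½≡1) (ℚP.*-identityˡ (p + q))))
  where
  regroup : ∀ h p q → h * p + h * q + (h * p + h * q) ≡ (h + h) * (p + q)
  regroup = solve 3 (λ h p q → h :* p :+ h :* q :+ (h :* p :+ h :* q) := (h :+ h) :* (p :+ q)) refl

-- Doubling turns the averages into sums, and the two points separate: the left side will be a lower
-- bound and the right side an upper bound on the next component of the subgradient.
average-gap : ∀ {κ b d Y Z} →
  κ + (ℚ.½ * Y + (1ℚ - ℚ.½) * Z) ≤ ℚ.½ * b + (1ℚ - ℚ.½) * d → κ + Y - b ≤ d - (κ + Z)
average-gap {κ} {b} {d} {Y} {Z} le = gap≤⁻¹ (+-nonNeg (gap≤ le) (gap≤ le)) (begin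
    d - (κ + Z)
      ≡⟨ solve 5 (λ κ b d Y Z → d :- (κ :+ Z) := κ :+ Y :- b :+ (b :+ d :- (κ :+ κ :+ (Y :+ Z)))) refl κ b d Y Z ⟩
    κ + Y - b + (b + d - (κ + κ + (Y + Z)))
      ≡⟨ cong₂ (λ s t → κ + Y - b + (s - (κ + κ + t))) (sym (half-sum b d)) (sym (half-sum Y Z)) ⟩
    κ + Y - b + (B + B - (κ + κ + (M + M)))
      ≡⟨ cong (λ s → κ + Y - b + s) (solve 3 (λ κ B M → B :+ B :- (κ :+ κ :+ (M :+ M)) := B :- (κ :+ M) :+ (B :- (κ :+ M))) refl κ B M) ⟩
    κ + Y - b + (B - (κ + M) + (B - (κ + M))) ∎)
  where
  open ≡-Reasoning
  B = ℚ.½ * b + (1ℚ - ℚ.½) * d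
  M = ℚ.½ * Y + (1ℚ - ℚ.½) * Z

average-± : ∀ c → ℚ.½ * ιℤ (ℤ.pred c) + (1ℚ - ℚ.½) * ιℤ (ℤ.suc c) ≡ ιℤ c
average-± c = begin
    ℚ.½ * ιℤ (ℤ.pred c) + (1ℚ - ℚ.½) * ιℤ (ℤ.suc c)
      ≡⟨ cong₂ (λ p q → ℚ.½ * p + (1ℚ - ℚ.½) * q) (ιℤ-+ ℤ.-[1+ 0 ] c) (ιℤ-+ (ℤ.+ 1) c) ⟩
    ℚ.½ * (- 1ℚ + ιℤ c) + (1ℚ - ℚ.½) * (1ℚ + ιℤ c)
      ≡⟨ cong (λ k → ℚ.½ * (- 1ℚ + ιℤ c) + k * (1ℚ + ιℤ c)) 1-½≡½ ⟩
    ℚ.½ * (- 1ℚ + ιℤ c) + ℚ.½ * (1ℚ + ιℤ c)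
      ≡⟨ regroup ℚ.½ 1ℚ (ιℤ c) ⟩
    (ℚ.½ + ℚ.½) * ιℤ c
      ≡⟨ cong (_* ιℤ c) ½+½≡1 ⟩
    1ℚ * ιℤ c
      ≡⟨ ℚP.*-identityˡ (ιℤ c) ⟩
    ιℤ c ∎
  where
  open ≡-Reasoning
  regroup : ∀ h e c → h * (- e + c) + h * (e + c) ≡ (h + h) * c
  regroup = solve 3 (λ h e c → h :* (:- e :+ c) :+ h :* (e :+ c) := (h :+ h) :* c) refl

-- Relative to `c`, the first coordinate of `y` is 0, 1 or -1, which is the coefficient of `q`: no
-- condition on `q`, an upper bound and a lower bound.
subgradient-∷ : ∀ {f : Vec ℤ (suc n) → ℤ∞} {c x a p q} →
  (∀ {y} → y ∈ neighbours x → Subgradient (λ y → f (c ∷ y)) x a p y) →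
  (∀ {y b} → y ∈ neighbours x → f (ℤ.pred c ∷ y) ≡ fin b → ⟨ p , y ⟩ ℤ.- b ℤ.- (⟨ p , x ⟩ ℤ.- a) ℤ.≤ q) →
  (∀ {y b} → y ∈ neighbours x → f (ℤ.suc c ∷ y) ≡ fin b → q ℤ.≤ ⟨ p , x ⟩ ℤ.- a ℤ.- (⟨ p , y ⟩ ℤ.- b)) →
  ∀ {y} → y ∈ neighbours (c ∷ x) → Subgradient f (c ∷ x) a (q ∷ p) y
subgradient-∷ {c = c} {x} {a} {p} {q} mid lo hi y∈ {b} fy
  with ∈-cartesianProductWith⁻ _∷_ (interval c) (neighbours x) y∈
... | _ , y , here refl , y∈′ , refl = gapℤ≤⁻¹ (ℤP.i≤j⇒0≤j-i (mid y∈′ fy))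
  (identity (q ℤ.* c) a b ⟨ p , x ⟩ ⟨ p , y ⟩)
  where
  identity : ∀ r a b X Y → r ℤ.+ X ℤ.- a ≡ r ℤ.+ Y ℤ.- b ℤ.+ (X ℤ.- a ℤ.- (Y ℤ.- b))
  identity = ℤ-solve 5 (λ r a b X Y → r ⊞ X ⊟ a ≐ r ⊞ Y ⊟ b ⊞ (X ⊟ a ⊟ (Y ⊟ b))) refl
... | _ , y , there (here refl) , y∈′ , refl = gapℤ≤⁻¹ (ℤP.i≤j⇒0≤j-i (hi y∈′ fy))
  (identity q c a b ⟨ p , x ⟩ ⟨ p , y ⟩)
  where
  identity : ∀ q c a b X Y → q ℤ.* c ℤ.+ X ℤ.- a ≡
    q ℤ.* (ℤ.+ 1 ℤ.+ c) ℤ.+ Y ℤ.- b ℤ.+ (X ℤ.- a ℤ.- (Y ℤ.- b) ℤ.- q)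
  identity = ℤ-solve 6 (λ q c a b X Y → q ⊠ c ⊞ X ⊟ a ≐
    q ⊠ (ℤ-con (ℤ.+ 1) ⊞ c) ⊞ Y ⊟ b ⊞ (X ⊟ a ⊟ (Y ⊟ b) ⊟ q)) refl
... | _ , y , there (there (here refl)) , y∈′ , refl = gapℤ≤⁻¹ (ℤP.i≤j⇒0≤j-i (lo y∈′ fy))
  (identity q c a b ⟨ p , x ⟩ ⟨ p , y ⟩)
  where
  identity : ∀ q c a b X Y → q ℤ.* c ℤ.+ X ℤ.- a ≡
    q ℤ.* (ℤ.-[1+ 0 ] ℤ.+ c) ℤ.+ Y ℤ.- b ℤ.+ (q ℤ.- (Y ℤ.- b ℤ.- (X ℤ.- a)))
  identity = ℤ-solve 6 (λ q c a b X Y → q ⊠ c ⊞ X ⊟ a ≐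
    q ⊠ (ℤ-con ℤ.-[1+ 0 ] ⊞ c) ⊞ Y ⊟ b ⊞ (q ⊟ (Y ⊟ b ⊟ (X ⊟ a)))) refl

midpoint-across : {f : Vec ℤ (suc n) → ℤ∞} → MidpointConvex f → ∀ {c y z b d} →
  f (ℤ.pred c ∷ y) ≡ fin b → f (ℤ.suc c ∷ z) ≡ fin d → Σ (List (Term n)) λ us →
    Feasible (λ w → f (c ∷ w)) ((ℚ.½ · ιv y) ⊕ ((1ℚ - ℚ.½) · ιv z)) us
    × cost us ≤ ℚ.½ * ιℤ b + (1ℚ - ℚ.½) * ιℤ d
midpoint-across {f = f} mc {c} {y} {z} {b} {d} fy fz =
  let vs , fe , le  = mc fy fz
      us , fe′ , eq = feasible-slice (subst (λ e → Feasible f (e ∷ ((ℚ.½ · ιv y) ⊕ ((1ℚ - ℚ.½) · ιv z))) vs) (average-± c) fe)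
  in us , fe′ , subst (_≤ ℚ.½ * ιℤ b + (1ℚ - ℚ.½) * ιℤ d) (sym eq) le

-- The compatibility needed by `separate`. The midpoint lies in the slice at `c`; there `p` bounds
-- the cost from below, and midpoint convexity bounds it from above by the average of `b` and `d`.
subgradient-across : {f : Vec ℤ (suc n) → ℤ∞} → MidpointConvex f → ∀ {c x a p} →
  (∀ {y} → y ∈ neighbours x → Subgradient (λ y → f (c ∷ y)) x a p y) →
  ∀ {y z b d} → y ∈ neighbours x → z ∈ neighbours x → f (ℤ.pred c ∷ y) ≡ fin b → f (ℤ.suc c ∷ z) ≡ fin d →
  ⟨ p , y ⟩ ℤ.- b ℤ.- (⟨ p , x ⟩ ℤ.- a) ℤ.≤ ⟨ p , x ⟩ ℤ.- a ℤ.- (⟨ p , z ⟩ ℤ.- d)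
subgradient-across {n} {f} mc {c} {x} {a} {p} sub {y} {z} {b} {d} y∈ z∈ fy fz =
  let us , fe , le = midpoint-across mc fy fz in
  ιℤ-cancel-≤ {⟨ p , y ⟩ ℤ.- b ℤ.- (⟨ p , x ⟩ ℤ.- a)} {⟨ p , x ⟩ ℤ.- a ℤ.- (⟨ p , z ⟩ ℤ.- d)}
    (subst₂ _≤_ (sym ι-lo) (sym ι-hi) (average-gap {κ} {ιℤ b} {ιℤ d} {ιv p ∙ ιv y} {ιv p ∙ ιv z}
      (ℚP.≤-trans
        (subst (_≤ cost us) (cong (λ e → κ + e) P∙mid) (feasible-bound κ (ιv p) fe λ {e} e∈N fe →
          subgradient-ι {f = λ w → f (c ∷ w)} {x} {a} {p} {e}
            (sub (within-InN⇒neighbour (within-convex ½≥0 ½≥0 x y∈ z∈) e∈N)) fe))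
        le)))
  where
  κ = ιℤ a - ιv p ∙ ιv x
  ½≥0 = ℚP.nonNegative⁻¹ ℚ.½
  P∙mid : ιv p ∙ ((ℚ.½ · ιv y) ⊕ ((1ℚ - ℚ.½) · ιv z)) ≡ ℚ.½ * (ιv p ∙ ιv y) + (1ℚ - ℚ.½) * (ιv p ∙ ιv z)
  P∙mid = trans (∙-distribˡ-⊕ (ιv p) (ℚ.½ · ιv y) ((1ℚ - ℚ.½) · ιv z))
    (cong₂ _+_ (∙-·ʳ ℚ.½ (ιv p) (ιv y)) (∙-·ʳ (1ℚ - ℚ.½) (ιv p) (ιv z)))
  ι-lo : ιℤ (⟨ p , y ⟩ ℤ.- b ℤ.- (⟨ p , x ⟩ ℤ.- a)) ≡ ιℤ a - ιv p ∙ ιv x + ιv p ∙ ιv y - ιℤ b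
  ι-lo = trans (ιℤ-- (⟨ p , y ⟩ ℤ.- b) (⟨ p , x ⟩ ℤ.- a))
    (trans (cong₂ _-_ (ι-⟨⟩- p y b) (ι-⟨⟩- p x a))
      (solve 4 (λ a b X Y → Y :- b :- (X :- a) := a :- X :+ Y :- b) refl
        (ιℤ a) (ιℤ b) (ιv p ∙ ιv x) (ιv p ∙ ιv y)))
  ι-hi : ιℤ (⟨ p , x ⟩ ℤ.- a ℤ.- (⟨ p , z ⟩ ℤ.- d)) ≡ ιℤ d - (ιℤ a - ιv p ∙ ιv x + ιv p ∙ ιv z)
  ι-hi = trans (ιℤ-- (⟨ p , x ⟩ ℤ.- a) (⟨ p , z ⟩ ℤ.- d))
    (trans (cong₂ _-_ (ι-⟨⟩- p x a) (ι-⟨⟩- p z d))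
      (solve 4 (λ a d X Z → X :- a :- (Z :- d) := d :- (a :- X :+ Z)) refl
        (ιℤ a) (ιℤ d) (ιv p ∙ ιv x) (ιv p ∙ ιv z)))

-- `p` is found first, on the slice through `x`. The inequalities of that slice imply those left
-- after eliminating `q`, so whichever `p` the induction returns extends by an integer `q`.
local-subgradient : {f : Vec ℤ n → ℤ∞} → MidpointConvex f → ∀ x {a} → f x ≡ fin a →
  Σ (Vec ℤ n) λ p → ∀ {y} → y ∈ neighbours x → Subgradient f x a p y
local-subgradient mc [] fx = [] , λ { {[]} _ fy → ℤP.≤-reflexive (cong (ℤ._-_ (ℤ.+ 0)) (fin-injective (trans (sym fy) fx))) }
  where
  fin-injective : ∀ {a b} → fin a ≡ fin b → a ≡ b
  fin-injective refl = refl
local-subgradient {suc n} {f} mc (c ∷ x) {a} fx =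
  let p , sub     = local-subgradient (midpoint-slice mc c) x fx
      q , lb , ub = separate
        (λ (y , b) → ⟨ p , y ⟩ ℤ.- b ℤ.- (⟨ p , x ⟩ ℤ.- a))
        (λ (z , d) → ⟨ p , x ⟩ ℤ.- a ℤ.- (⟨ p , z ⟩ ℤ.- d))
        (graph below (neighbours x)) (graph above (neighbours x))
        λ s∈ t∈ → let y∈ , fy = ∈-graph⁻ below (neighbours x) s∈
                      z∈ , fz = ∈-graph⁻ above (neighbours x) t∈
                  in subgradient-across mc {x = x} {a} {p} sub y∈ z∈ fy fz
  in q ∷ p , subgradient-∷ {f = f} {x = x} {a} {p} {q} sub
    (λ y∈ fy → lb (∈-graph⁺ below y∈ fy))
    (λ y∈ fy → ub (∈-graph⁺ above y∈ fy))
  where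
  below above : Vec ℤ n → ℤ∞
  below y = f (ℤ.pred c ∷ y)
  above y = f (ℤ.suc c ∷ y)

-- From the neighbours of a point to all points

i≤+∣i∣ : ∀ i → i ℤ.≤ ℤ.+ ℤ.∣ i ∣
i≤+∣i∣ (ℤ.+ _)    = ℤP.≤-refl
i≤+∣i∣ ℤ.-[1+ _ ] = ℤ.-≤+

dist : Vec ℤ n → Vec ℤ n → ℕ
dist []      []      = 0
dist (a ∷ x) (b ∷ y) = ℤ.∣ a ℤ.- b ∣ ℕ.+ dist x y

reciprocal : ∀ {α} → 0ℚ < α → Σ ℚ λ s → 0ℚ < s × s * α ≡ 1ℚ
reciprocal {α} 0<α = ℚ.1/ α , ℚP.positive⁻¹ (ℚ.1/ α) {{ℚP.1/pos⇒pos α {{ℚ.positive 0<α}}}} , ℚP.*-inverseˡ α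
  where instance α≢0 = ℚP.pos⇒nonZero α {{ℚ.positive 0<α}}

∣-∣≤⇒ι-gap : ∀ {a b K} → ℤ.∣ a ℤ.- b ∣ ℕ.≤ K → ιℤ a - ιℤ b ≤ ιℤ (ℤ.+ K)
∣-∣≤⇒ι-gap {a} {b} {K} le = subst (_≤ ιℤ (ℤ.+ K)) (ιℤ-- a b)
  (ιℤ-mono-≤ {a ℤ.- b} {ℤ.+ K} (ℤP.≤-trans (i≤+∣i∣ (a ℤ.- b)) (ℤ.+≤+ le)))

-- `K` bounds every coordinate difference, so no coordinate moves by more than one. It is kept apart
-- from `dist y x`, which shrinks along the recursion while `t` stays.
within-towards : ∀ {t K} → 0ℚ ≤ t → t * ιℤ (ℤ.+ K) ≤ 1ℚ → (y x : Vec ℤ n) → dist y x ℕ.≤ K →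
  Within ((t · ιv y) ⊕ ((1ℚ - t) · ιv x)) x
within-towards _ _ [] [] _ = []
within-towards {t = t} {K} 0≤t tK≤1 (d ∷ y) (c ∷ x) le =
  ( gap≤⁻¹ (+-nonNeg (gap≤ tK≤1) (*-nonNeg 0≤t (gap≤ (∣-∣≤⇒ι-gap {c} {d} {K}
      (subst (ℕ._≤ K) (ℤP.∣i-j∣≡∣j-i∣ d c) ∣d-c∣≤K)))))
      (solve 4 (λ t k c d → t :* d :+ (con 1ℚ :- t) :* c
        := c :- con 1ℚ :+ (con 1ℚ :- t :* k :+ t :* (k :- (c :- d)))) refl t (ιℤ (ℤ.+ K)) (ιℤ c) (ιℤ d))
  , gap≤⁻¹ (+-nonNeg (gap≤ tK≤1) (*-nonNeg 0≤t (gap≤ (∣-∣≤⇒ι-gap {d} {c} {K} ∣d-c∣≤K))))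
      (solve 4 (λ t k c d → c :+ con 1ℚ := t :* d :+ (con 1ℚ :- t) :* c
        :+ (con 1ℚ :- t :* k :+ t :* (k :- (d :- c)))) refl t (ιℤ (ℤ.+ K)) (ιℤ c) (ιℤ d)) )
  ∷ within-towards 0≤t tK≤1 y x (ℕP.≤-trans (ℕP.m≤n+m (dist y x) ℤ.∣ d ℤ.- c ∣) le)
  where
  ∣d-c∣≤K : ℤ.∣ d ℤ.- c ∣ ℕ.≤ K
  ∣d-c∣≤K = ℕP.≤-trans (ℕP.m≤m+n ℤ.∣ d ℤ.- c ∣ (dist y x)) le

small-step : ∀ K → Σ ℚ λ t → 0ℚ < t × t < 1ℚ × t * ιℤ (ℤ.+ K) < 1ℚ
-- `t = 1/(K + 2)`: the denominator exceeds both 1 and `K`, also when `K` is 0.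
small-step K = let t , 0<t , eq = reciprocal (0<ιℤ (suc K)) in t , 0<t
  , gap<⁻¹ (ℚP.<-≤-trans 0<t (gap≤⁻¹ (*-nonNeg (ℚP.<⇒≤ 0<t) (0≤ιℤ K)) refl))
      (trans (sym (trans (cong (t *_) split) eq))
        (solve 2 (λ t k → t :* (con 1ℚ :+ (con 1ℚ :+ k)) := t :+ (t :+ t :* k)) refl t (ιℤ (ℤ.+ K))))
  , gap<⁻¹ (ℚP.<-≤-trans 0<t (gap≤⁻¹ (ℚP.<⇒≤ 0<t) refl))
      (trans (sym (trans (cong (t *_) split) eq))
        (solve 2 (λ t k → t :* (con 1ℚ :+ (con 1ℚ :+ k)) := t :* k :+ (t :+ t)) refl t (ιℤ (ℤ.+ K))))
  where
  split : 1ℚ + (1ℚ + ιℤ (ℤ.+ K)) ≡ ιℤ (ℤ.+ suc (suc K))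
  split = sym (trans (ιℤ-+ (ℤ.+ 1) (ℤ.+ suc K)) (cong (λ q → 1ℚ + q) (ιℤ-+ (ℤ.+ 1) (ℤ.+ K))))

-- A short step `t` from `x` towards `y` reaches a point whose N consists of neighbours of `x`.
-- Comparing the bound from `p` with the convex upper bound leaves `t` times the wanted inequality.
global-subgradient : ∀ {f : Vec ℤ n → ℤ∞} {x a p} → IntegrallyConvex f → f x ≡ fin a →
  (∀ {y} → y ∈ neighbours x → Subgradient f x a p y) → ∀ y → Subgradient f x a p y
global-subgradient {f = f} {x} {a} {p} ic fx sub y {b} fy =
  let t , 0<t , t<1 , tK<1 = small-step (dist y x)
      vs , fe , le = feasible-segment ic fy fx 0<t t<1
      bound = feasible-bound κ (ιv p) fe λ {e} e∈N fe →
        subgradient-ι {f = f} {x} {a} {p} {e}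
          (sub (within-InN⇒neighbour (within-towards (ℚP.<⇒≤ 0<t) (ℚP.<⇒≤ tK<1) y x ℕP.≤-refl) e∈N)) fe
      bound′ = ℚP.≤-trans (subst (_≤ cost vs) (cong (λ e → κ + e) (P∙ t)) bound) le
  in ιℤ-cancel-≤ {⟨ p , y ⟩ ℤ.- b} {⟨ p , x ⟩ ℤ.- a} (subst₂ _≤_ (sym (ι-⟨⟩- p y b)) (sym (ι-⟨⟩- p x a))
      (ℚP.*-cancelˡ-≤-pos t {{ℚ.positive 0<t}} (gap≤⁻¹ (gap≤ bound′)
        (solve 5 (λ t a b X Y → t :* (X :- a) := t :* (Y :- b)
          :+ (t :* b :+ (con 1ℚ :- t) :* a :- (a :- X :+ (t :* Y :+ (con 1ℚ :- t) :* X)))) refl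
          t (ιℤ a) (ιℤ b) (ιv p ∙ ιv x) (ιv p ∙ ιv y)))))
  where
  κ = ιℤ a - ιv p ∙ ιv x
  P∙ : ∀ t → ιv p ∙ ((t · ιv y) ⊕ ((1ℚ - t) · ιv x)) ≡ t * (ιv p ∙ ιv y) + (1ℚ - t) * (ιv p ∙ ιv x)
  P∙ t = trans (∙-distribˡ-⊕ (ιv p) (t · ιv y) ((1ℚ - t) · ιv x))
    (cong₂ _+_ (∙-·ʳ t (ιv p) (ιv y)) (∙-·ʳ (1ℚ - t) (ιv p) (ιv x)))

-- Feasible rays from a point of the effective domain

direction : Vec ℤ n → Vec ℤ n → Vec ℚ n
direction = Vec.zipWith λ b a → ιℤ a - ιℤ b

∙-direction : (P : Vec ℚ n) (x y : Vec ℤ n) → P ∙ direction x y ≡ P ∙ ιv y - P ∙ ιv x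
∙-direction []      []      []      = refl
∙-direction (p ∷ P) (b ∷ x) (a ∷ y) rewrite ∙-direction P x y =
  solve 5 (λ p a b X Y → p :* (a :- b) :+ (Y :- X) := p :* a :+ Y :- (p :* b :+ X)) refl
    p (ιℤ a) (ιℤ b) (P ∙ ιv x) (P ∙ ιv y)

-- `σ = 1/(1 + tρ)` makes `1 − σ = σtρ`, so averaging a point on the ray of `w` with `y` lands on
-- the ray of `t (y − x) + w`, with the step shortened by `σ`.
ray-combine : ∀ {ρ σ t} → σ * (1ℚ + t * ρ) ≡ 1ℚ → (x y : Vec ℤ n) (w : Vec ℚ n) →
  (σ · (ιv x ⊕ (ρ · w))) ⊕ ((1ℚ - σ) · ιv y) ≡ ιv x ⊕ ((ρ * σ) · ((t · direction x y) ⊕ w))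
ray-combine                 eq []      []      []      = refl
ray-combine {ρ = ρ} {σ} {t} eq (b ∷ x) (a ∷ y) (c ∷ w) = cong₂ _∷_
  (trans (solve 6 (λ ρ σ t a b c → σ :* (b :+ ρ :* c) :+ (con 1ℚ :- σ) :* a
        := b :+ ρ :* σ :* (t :* (a :- b) :+ c) :+ (con 1ℚ :- σ :* (con 1ℚ :+ t :* ρ)) :* (a :- b)) refl ρ σ t (ιℤ a) (ιℤ b) c)
    (trans (cong (λ e → ιℤ b + ρ * σ * (t * (ιℤ a - ιℤ b) + c) + (1ℚ - e) * (ιℤ a - ιℤ b)) eq)
      (solve 2 (λ s d → s :+ (con 1ℚ :- con 1ℚ) :* d := s) refl
        (ιℤ b + ρ * σ * (t * (ιℤ a - ιℤ b) + c)) (ιℤ a - ιℤ b))))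
  (ray-combine {ρ = ρ} {σ} {t} eq x y w)

·-zeroʳ : (t : ℚ) → t · zeroV n ≡ zeroV n
·-zeroʳ {zero}  t = refl
·-zeroʳ {suc n} t = cong₂ _∷_ (ℚP.*-zeroʳ t) (·-zeroʳ t)

-- Generators are added one at a time: integral convexity merges the family on the ray found so far
-- with the point `y`. Each merge shortens the step, hence only some `ρ ≤ ρ₀` is promised.
cone⇒feasible-ray : ∀ {f : Vec ℤ n → ℤ∞} {x a ρ₀} → IntegrallyConvex f → f x ≡ fin a → 0ℚ < ρ₀ →
  (G : List (Vec ℤ n × ℤ)) → (∀ {y b} → (y , b) ∈ G → f y ≡ fin b) →
  ∀ {v} → InCone (List.map (λ (y , _) → direction x y) G) v →
  Σ ℚ λ ρ → 0ℚ < ρ × ρ ≤ ρ₀ × Σ (List (Term n)) λ ts → Feasible f (ιv x ⊕ (ρ · v)) ts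
cone⇒feasible-ray {f = f} {x} {a} {ρ₀} ic fx 0<ρ₀ [] _ refl = ρ₀ , 0<ρ₀ , ℚP.≤-refl , term x 1ℚ a ∷ [] ,
  subst (λ z → Feasible f z (term x 1ℚ a ∷ []))
    (sym (trans (cong (ιv x ⊕_) (·-zeroʳ ρ₀)) (trans (⊕-comm (ιv x) (zeroV _)) (⊕-identityˡ (ιv x)))))
    (feasible-singleton fx)
cone⇒feasible-ray {f = f} {x} ic fx 0<ρ₀ ((y , b) ∷ G) graph⊆ (t , 0≤t , w , w∈ , refl)
  with cone⇒feasible-ray ic fx 0<ρ₀ G (graph⊆ ∘ there) w∈ | 0ℚ ℚP.<? t
... | ρ , 0<ρ , ρ≤ρ₀ , ts , fe | no 0≮t = ρ , 0<ρ , ρ≤ρ₀ , ts ,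
  subst (λ v → Feasible f (ιv x ⊕ (ρ · v)) ts)
    (sym (trans (cong (λ t → (t · direction x y) ⊕ w) (ℚP.≤-antisym (ℚP.≮⇒≥ 0≮t) 0≤t))
      (trans (cong (_⊕ w) (·-zeroˡ (direction x y))) (⊕-identityˡ w)))) fe
... | ρ , 0<ρ , ρ≤ρ₀ , ts , fe | yes 0<t =
  let 0<tρ = *-pos 0<t 0<ρ
      σ , 0<σ , eq = reciprocal (ℚP.+-mono-≤-< (0≤ιℤ 1) 0<tρ)
      0<1-σ = subst (0ℚ <_) (trans (sym (+-cancel σ (t * ρ))) (cong (_- σ) eq)) (*-pos 0<σ 0<tρ)
      σ<1 = gap<⁻¹ 0<1-σ (solve 1 (λ σ → con 1ℚ := σ :+ (con 1ℚ :- σ)) refl σ)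
      vs , fe′ , _ = feasible-convex ic fe (feasible-singleton (graph⊆ (here refl))) 0<σ σ<1
  in ρ * σ , *-pos 0<ρ 0<σ
   , ℚP.≤-trans (gap≤⁻¹ (*-nonNeg (ℚP.<⇒≤ 0<ρ) (ℚP.<⇒≤ 0<1-σ))
        (solve 2 (λ ρ σ → ρ := ρ :* σ :+ ρ :* (con 1ℚ :- σ)) refl ρ σ)) ρ≤ρ₀
   , vs , subst (λ z → Feasible f z vs) (ray-combine {ρ = ρ} {σ} {t} eq x y w) fe′
  where
  +-cancel : ∀ σ e → σ * (1ℚ + e) - σ ≡ σ * e
  +-cancel = solve 2 (λ σ e → σ :* (con 1ℚ :+ e) :- σ := σ :* e) refl

∣i-1+j∣<∣i-j∣ : ∀ {i j} → j ℤ.< i → ℤ.∣ i ℤ.- ℤ.suc j ∣ ℕ.< ℤ.∣ i ℤ.- j ∣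
∣i-1+j∣<∣i-j∣ {i} {j} j<i = ℤP.drop‿+<+ (subst₂ ℤ._<_
  (sym (ℤP.0≤i⇒+∣i∣≡i (ℤP.i≤j⇒0≤j-i (ℤP.i<j⇒suc[i]≤j j<i))))
  (sym (ℤP.0≤i⇒+∣i∣≡i (ℤP.i≤j⇒0≤j-i (ℤP.<⇒≤ j<i))))
  (ℤP.+-monoʳ-< i (ℤP.neg-mono-< (ℤP.suc[i]≤j⇒i<j ℤP.≤-refl))))

∣i-pred[j]∣<∣i-j∣ : ∀ {i j} → i ℤ.< j → ℤ.∣ i ℤ.- ℤ.pred j ∣ ℕ.< ℤ.∣ i ℤ.- j ∣
∣i-pred[j]∣<∣i-j∣ {i} {j} i<j = ℤP.drop‿+<+ (subst₂ ℤ._<_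
  (trans (sym (ℤP.0≤i⇒+∣i∣≡i (ℤP.i≤j⇒0≤j-i (ℤP.i<j⇒i≤pred[j] i<j)))) (cong ℤ.+_ (ℤP.∣i-j∣≡∣j-i∣ (ℤ.pred j) i)))
  (trans (sym (ℤP.0≤i⇒+∣i∣≡i (ℤP.i≤j⇒0≤j-i (ℤP.<⇒≤ i<j)))) (cong ℤ.+_ (ℤP.∣i-j∣≡∣j-i∣ j i)))
  (ℤP.+-monoˡ-< (ℤ.- i) (ℤP.i≤pred[j]⇒i<j {ℤ.pred j} {j} ℤP.≤-refl)))

ray-coordinate-up : ∀ {ρ K a b} → 0ℚ < ρ → ρ * ιℤ (ℤ.+ K) < 1ℚ → ℤ.∣ a ℤ.- b ∣ ℕ.≤ K → b ℤ.< a →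
  ιℤ b ≤ ιℤ b + ρ * (ιℤ a - ιℤ b) × ιℤ b + ρ * (ιℤ a - ιℤ b) < ιℤ b + 1ℚ
ray-coordinate-up {ρ} {K} {a} {b} 0<ρ ρK<1 a-b≤K b<a =
    gap≤⁻¹ (*-nonNeg (ℚP.<⇒≤ 0<ρ) (gap≤ (ιℤ-mono-≤ {b} {a} (ℤP.<⇒≤ b<a)))) refl
  , gap<⁻¹ (ℚP.+-mono-<-≤ (gap< ρK<1) (*-nonNeg (ℚP.<⇒≤ 0<ρ) (gap≤ (∣-∣≤⇒ι-gap {a} {b} a-b≤K))))
      (solve 4 (λ ρ k a b → b :+ con 1ℚ := b :+ ρ :* (a :- b) :+ (con 1ℚ :- ρ :* k :+ ρ :* (k :- (a :- b))))
        refl ρ (ιℤ (ℤ.+ K)) (ιℤ a) (ιℤ b))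

ιℤ-pred : ∀ b → ιℤ (ℤ.pred b) ≡ ιℤ b - 1ℚ
ιℤ-pred b = trans (ιℤ-+ ℤ.-[1+ 0 ] b) (ℚP.+-comm (- 1ℚ) (ιℤ b))

ray-coordinate-down : ∀ {ρ K a b} → 0ℚ < ρ → ρ * ιℤ (ℤ.+ K) < 1ℚ → ℤ.∣ a ℤ.- b ∣ ℕ.≤ K → a ℤ.< b →
  ιℤ (ℤ.pred b) ≤ ιℤ b + ρ * (ιℤ a - ιℤ b) × ιℤ b + ρ * (ιℤ a - ιℤ b) < ιℤ (ℤ.pred b) + 1ℚ
ray-coordinate-down {ρ} {K} {a} {b} 0<ρ ρK<1 a-b≤K a<b =
  subst (λ q → q ≤ ιℤ b + ρ * (ιℤ a - ιℤ b) × ιℤ b + ρ * (ιℤ a - ιℤ b) < q + 1ℚ) (sym (ιℤ-pred b))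
    ( gap≤⁻¹ (+-nonNeg (gap≤ (ℚP.<⇒≤ ρK<1)) (*-nonNeg (ℚP.<⇒≤ 0<ρ) (gap≤ b-a≤K)))
        (solve 4 (λ ρ k a b → b :+ ρ :* (a :- b) := b :- con 1ℚ :+ (con 1ℚ :- ρ :* k :+ ρ :* (k :- (b :- a))))
          refl ρ (ιℤ (ℤ.+ K)) (ιℤ a) (ιℤ b))
    , gap<⁻¹ (*-pos 0<ρ (gap< (ιℤ-mono-< {a} {b} a<b)))
        (solve 3 (λ ρ a b → b :- con 1ℚ :+ con 1ℚ := b :+ ρ :* (a :- b) :+ ρ :* (b :- a))
          refl ρ (ιℤ a) (ιℤ b)) )
  where
  b-a≤K : ιℤ b - ιℤ a ≤ ιℤ (ℤ.+ K)
  b-a≤K = ∣-∣≤⇒ι-gap {b} {a} (subst (ℕ._≤ K) (ℤP.∣i-j∣≡∣j-i∣ a b) a-b≤K)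

-- The coordinate moves from `b` towards `a` by less than one, so the only candidates for `c` are
-- `b` and the next integer towards `a`.
closer-coordinate : ∀ {ρ K a b c} → 0ℚ < ρ → ρ * ιℤ (ℤ.+ K) < 1ℚ → ℤ.∣ a ℤ.- b ∣ ℕ.≤ K →
  ℚ.∣ ιℤ b + ρ * (ιℤ a - ιℤ b) - ιℤ c ∣ < 1ℚ →
  c ∈ interval b × (c ≡ b ⊎ ℤ.∣ a ℤ.- c ∣ ℕ.< ℤ.∣ a ℤ.- b ∣)
closer-coordinate {ρ} {K} {a} {b} {c} 0<ρ ρK<1 a-b≤K lt = cases (ℤP.<-cmp a b)
  where
  up : b ℤ.< a → c ∈ (b ∷ ℤ.suc b ∷ []) → c ∈ interval b × (c ≡ b ⊎ ℤ.∣ a ℤ.- c ∣ ℕ.< ℤ.∣ a ℤ.- b ∣)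
  up b<a (here c≡b)          = here c≡b , inj₁ c≡b
  up b<a (there (here refl)) = there (here refl) , inj₂ (∣i-1+j∣<∣i-j∣ b<a)

  down : a ℤ.< b → c ∈ (ℤ.pred b ∷ ℤ.suc (ℤ.pred b) ∷ []) →
    c ∈ interval b × (c ≡ b ⊎ ℤ.∣ a ℤ.- c ∣ ℕ.< ℤ.∣ a ℤ.- b ∣)
  down a<b (here refl)       = there (there (here refl)) , inj₂ (∣i-pred[j]∣<∣i-j∣ a<b)
  down a<b (there (here c≡)) = let c≡b = trans c≡ (ℤP.suc-pred b) in here c≡b , inj₁ c≡b

  cases : Tri (a ℤ.< b) (a ≡ b) (b ℤ.< a) → c ∈ interval b × (c ≡ b ⊎ ℤ.∣ a ℤ.- c ∣ ℕ.< ℤ.∣ a ℤ.- b ∣)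
  cases (tri< a<b _ _) =
    let lo , hi = ray-coordinate-down {ρ} {K} {a} {b} 0<ρ ρK<1 a-b≤K a<b
    in down a<b (unit-gap {b = ℤ.pred b} {c} lo hi lt)
  cases (tri> _ _ b<a) =
    let lo , hi = ray-coordinate-up {ρ} {K} {a} {b} 0<ρ ρK<1 a-b≤K b<a
    in up b<a (unit-gap {b = b} {c} lo hi lt)
  cases (tri≈ _ refl _) = let c≡b = InN-integer-head {c = b} (still ∷ []) in here c≡b , inj₁ c≡b
    where
    still : ℚ.∣ ιℤ b - ιℤ c ∣ < 1ℚ
    still = subst (λ q → ℚ.∣ q - ιℤ c ∣ < 1ℚ) (solve 2 (λ ρ a → a :+ ρ :* (a :- a) := a) refl ρ (ιℤ b)) lt

-- The L¹ distance is a sum over coordinates, none of which gets farther, so one strictly closer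
-- coordinate makes the whole point closer.
closer-or-equal : ∀ {ρ K} → 0ℚ < ρ → ρ * ιℤ (ℤ.+ K) < 1ℚ → (x x₀ : Vec ℤ n) → dist x x₀ ℕ.≤ K →
  ∀ {e} → InN (ιv x₀ ⊕ (ρ · direction x₀ x)) e → e ∈ neighbours x₀ × (e ≡ x₀ ⊎ dist x e ℕ.< dist x x₀)
closer-or-equal _ _ [] [] _ {[]} _ = here refl , inj₁ refl
closer-or-equal {K = K} 0<ρ ρK<1 (a ∷ x) (b ∷ x₀) le {c ∷ e} (lt ∷ e∈N) =
  let c∈ , c? = closer-coordinate {K = K} {a} {b} {c} 0<ρ ρK<1 (ℕP.≤-trans (ℕP.m≤m+n ℤ.∣ a ℤ.- b ∣ (dist x x₀)) le) lt
      e∈ , e? = closer-or-equal 0<ρ ρK<1 x x₀ (ℕP.≤-trans (ℕP.m≤n+m (dist x x₀) ℤ.∣ a ℤ.- b ∣) le) e∈N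
  in ∈-cartesianProductWith⁺ _∷_ c∈ e∈ , combine c? e?
  where
  combine : ∀ {e} → c ≡ b ⊎ ℤ.∣ a ℤ.- c ∣ ℕ.< ℤ.∣ a ℤ.- b ∣ → e ≡ x₀ ⊎ dist x e ℕ.< dist x x₀ →
    c ∷ e ≡ b ∷ x₀ ⊎ dist (a ∷ x) (c ∷ e) ℕ.< dist (a ∷ x) (b ∷ x₀)
  combine (inj₁ refl) (inj₁ refl) = inj₁ refl
  combine (inj₁ refl) (inj₂ lt′)  = inj₂ (ℕP.+-monoʳ-< ℤ.∣ a ℤ.- b ∣ lt′)
  combine (inj₂ lt)   (inj₁ refl) = inj₂ (ℕP.+-monoˡ-< (dist x x₀) lt)
  combine (inj₂ lt)   (inj₂ lt′)  = inj₂ (ℕP.+-mono-< lt lt′)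

vsum-constant : ∀ {y} (ts : List (Term n)) → All (λ t → pt t ≡ y) ts → vsum ts ≡ wsum ts · ιv y
vsum-constant {y = y} []       []         = sym (·-zeroˡ (ιv y))
vsum-constant {y = y} (t ∷ ts) (refl ∷ h) =
  trans (cong ((weight t · ιv y) ⊕_) (vsum-constant ts h)) (sym (·-distribʳ (weight t) (wsum ts) (ιv y)))

still-ray⇒equal : ∀ {ρ} → 0ℚ < ρ → (x₀ x : Vec ℤ n) → ιv x₀ ⊕ (ρ · direction x₀ x) ≡ ιv x₀ → x ≡ x₀
still-ray⇒equal         0<ρ []       []      _  = refl
still-ray⇒equal {ρ = ρ} 0<ρ (b ∷ x₀) (a ∷ x) eq = cong₂ _∷_
  (ℤP.≤-antisym (ιℤ-cancel-≤ {a} {b} (ℚP.≤-reflexive ιa≡ιb)) (ιℤ-cancel-≤ {b} {a} (ℚP.≤-reflexive (sym ιa≡ιb))))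
  (still-ray⇒equal 0<ρ x₀ x (cong Vec.tail eq))
  where
  head≡ : ιℤ b + ρ * (ιℤ a - ιℤ b) ≡ ιℤ b
  head≡ = cong Vec.head eq
  ρa≡ρb : ρ * ιℤ a ≡ ρ * ιℤ b
  ρa≡ρb = trans (solve 3 (λ ρ a b → ρ :* a := b :+ ρ :* (a :- b) :- b :+ ρ :* b) refl ρ (ιℤ a) (ιℤ b))
    (trans (cong (λ e → e - ιℤ b + ρ * ιℤ b) head≡) (solve 2 (λ b c → b :- b :+ c := c) refl (ιℤ b) (ρ * ιℤ b)))
  ιa≡ιb : ιℤ a ≡ ιℤ b
  ιa≡ιb = ℚP.≤-antisym (ℚP.*-cancelˡ-≤-pos ρ {{ℚ.positive 0<ρ}} (ℚP.≤-reflexive ρa≡ρb))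
    (ℚP.*-cancelˡ-≤-pos ρ {{ℚ.positive 0<ρ}} (ℚP.≤-reflexive (sym ρa≡ρb)))

-- Points outside the effective domain

-- Only a local minimum of the distance: `x₀` is compared with finitely many points, so descent
-- finds one by decidable tests.
Nearest : (Vec ℤ n → ℤ∞) → Vec ℤ n → Vec ℤ n → Set
Nearest f x x₀ = ∀ {y b} → y ∈ neighbours x₀ → f y ≡ fin b → ¬ dist x y ℕ.< dist x x₀

nearest : (f : Vec ℤ n → ℤ∞) (x : Vec ℤ n) → ∀ x₀ {a} → f x₀ ≡ fin a → Acc ℕ._<_ (dist x x₀) →
  Σ (Vec ℤ n) λ x₀ → Σ ℤ λ a → f x₀ ≡ fin a × Nearest f x x₀
nearest f x x₀ {a} fx₀ (acc rec)
  with Any.any? (λ (y , _) → dist x y ℕP.<? dist x x₀) (graph f (neighbours x₀))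
... | no ¬closer = x₀ , a , fx₀ , λ y∈ fy lt → ¬closer (Any.map (λ { refl → lt }) (∈-graph⁺ f y∈ fy))
... | yes closer with find closer
... | (y , b) , y∈ , lt = nearest f x y (proj₂ (∈-graph⁻ f (neighbours x₀) y∈)) (rec lt)

clear-denominators : (u : Vec ℚ n) → Σ ℤ λ k → ℤ.+ 0 ℤ.< k × Σ (Vec ℤ n) λ q → ιv q ≡ ιℤ k · u
clear-denominators []      = ℤ.+ 1 , ℤ.+<+ ℕ.z<s , [] , refl
clear-denominators (h ∷ u) with clear-denominators u
... | k , 0<k , q , eq = ℚ.↧ h ℤ.* k
  , ιℤ-cancel-< {ℤ.+ 0} {ℚ.↧ h ℤ.* k} (subst (0ℚ <_) (sym (ιℤ-* (ℚ.↧ h) k)) (*-pos (0<↧ h) (ιℤ-mono-< {ℤ.+ 0} {k} 0<k)))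
  , ℚ.↥ h ℤ.* k ∷ Vec.map (ℚ.↧ h ℤ.*_) q
  , cong₂ _∷_
      (trans (ιℤ-* (ℚ.↥ h) k) (trans (cong (_* ιℤ k) (sym (*-↧ h)))
        (trans (solve 3 (λ h d k → h :* d :* k := d :* k :* h) refl h (ιℤ (ℚ.↧ h)) (ιℤ k))
          (cong (_* h) (sym (ιℤ-* (ℚ.↧ h) k))))))
      (scale q u eq)
  where
  scale : ∀ {m} (q : Vec ℤ m) (u : Vec ℚ m) → ιv q ≡ ιℤ k · u →
    ιv (Vec.map (ℚ.↧ h ℤ.*_) q) ≡ ιℤ (ℚ.↧ h ℤ.* k) · u
  scale []      []      _  = refl
  scale (c ∷ q) (a ∷ u) eq = cong₂ _∷_
    (trans (ιℤ-* (ℚ.↧ h) c) (trans (cong (λ e → ιℤ (ℚ.↧ h) * e) (cong Vec.head eq))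
      (trans (sym (ℚP.*-assoc (ιℤ (ℚ.↧ h)) (ιℤ k) a)) (cong (_* a) (sym (ιℤ-* (ℚ.↧ h) k))))))
    (scale q u (cong Vec.tail eq))

cone-generator : ∀ {A : List (Vec ℚ n)} {a} → a ∈ A → InCone A a
cone-generator {A = A} {a} a∈ = subst (InCone A)
  (trans (cong (_⊕ zeroV _) (·-identityˡ a)) (trans (⊕-comm a (zeroV _)) (⊕-identityˡ a)))
  (cone-add a∈ (0≤ιℤ 1) (cone-zero A))

separating-covector : ∀ {f : Vec ℤ n → ℤ∞} {x x₀ a} → IntegrallyConvex f → f x ≡ +∞ → f x₀ ≡ fin a →
  Nearest f x x₀ → Σ (Vec ℚ n) λ u →
    0ℚ < u ∙ direction x₀ x × (∀ {y b} → y ∈ neighbours x₀ → f y ≡ fin b → u ∙ direction x₀ y ≤ 0ℚ)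
separating-covector {n} {f} {x} {x₀} {a} ic fx fx₀ near
  -- Either a normal of the cone of feasible directions at `x₀` separates `x − x₀` from it, or
  -- Weyl's theorem puts `x − x₀` into the cone.
  with Any.any? (λ u → 0ℚ ℚP.<? u ∙ direction x₀ x) (polar directions)
  where
  directions : List (Vec ℚ n)
  directions = List.map (λ (y , _) → direction x₀ y) (graph f (neighbours x₀))
... | yes found = let u , u∈ , 0<u∙ = find found in u , 0<u∙ , λ y∈ fy →
  cone⇒polar _ (cone-generator (∈-map⁺ (λ (y , _) → direction x₀ y) (∈-graph⁺ f y∈ fy))) u∈
... | no ¬found =
  let ρ₀ , 0<ρ₀ , _ , ρ₀K<1 = small-step (dist x x₀)
      ρ , 0<ρ , ρ≤ρ₀ , ts , h , vs , ws = cone⇒feasible-ray ic fx₀ 0<ρ₀ (graph f (neighbours x₀))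
        (λ y∈ → proj₂ (∈-graph⁻ f (neighbours x₀) y∈))
        (polar⇒cone _ λ {u} u∈ → ℚP.≮⇒≥ λ lt → ¬found (Any.map (λ { refl → lt }) u∈))
      ρK<1 = ℚP.≤-<-trans (ℚP.*-monoʳ-≤-nonNeg (ιℤ (ℤ.+ dist x x₀)) {{ℚ.nonNegative (0≤ιℤ (dist x x₀))}} ρ≤ρ₀) ρ₀K<1
  in ⊥-elim (impossible ρ 0<ρ ρK<1 ts (h , vs , ws))
  where
  impossible : ∀ ρ → 0ℚ < ρ → ρ * ιℤ (ℤ.+ dist x x₀) < 1ℚ → ∀ ts → ¬ Feasible f (ιv x₀ ⊕ (ρ · direction x₀ x)) ts
  impossible ρ 0<ρ ρK<1 ts (h , vs , ws) = +∞≢fin (trans (sym fx) (trans (cong f x≡x₀) fx₀))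
    where
    +∞≢fin : ∀ {a} → ¬ (+∞ ≡ fin a)
    +∞≢fin ()
    -- A point of the family other than `x₀` would be a closer neighbour, against `Nearest`. So the
    -- whole family sits at `x₀`, and the ray stands still.
    stay : ∀ {t} → InN (ιv x₀ ⊕ (ρ · direction x₀ x)) (pt t) × 0ℚ < weight t × f (pt t) ≡ fin (value t) → pt t ≡ x₀
    stay (e∈N , _ , fe) with closer-or-equal 0<ρ ρK<1 x x₀ ℕP.≤-refl e∈N
    ... | _  , inj₁ e≡x₀ = e≡x₀
    ... | e∈ , inj₂ lt   = ⊥-elim (near e∈ fe lt)
    x≡x₀ : x ≡ x₀
    x≡x₀ = still-ray⇒equal 0<ρ x₀ x (trans (sym vs)
      (trans (vsum-constant ts (All.map stay h)) (trans (cong (_· ιv x₀) ws) (·-identityˡ (ιv x₀)))))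

direction-ι : (q x y : Vec ℤ n) → ιv q ∙ direction x y ≡ ιℤ (⟨ q , y ⟩ ℤ.- ⟨ q , x ⟩)
direction-ι q x y = trans (∙-direction (ιv q) x y)
  (sym (trans (ιℤ-- ⟨ q , y ⟩ ⟨ q , x ⟩) (cong₂ _-_ (ι-⟨⟩ q y) (ι-⟨⟩ q x))))

integral-separation : ∀ {f : Vec ℤ n → ℤ∞} {x x₀ a} → IntegrallyConvex f → f x ≡ +∞ → f x₀ ≡ fin a →
  Nearest f x x₀ → Σ (Vec ℤ n) λ q → ⟨ q , x₀ ⟩ ℤ.< ⟨ q , x ⟩
    × (∀ {y b} → y ∈ neighbours x₀ → f y ≡ fin b → ⟨ q , y ⟩ ℤ.≤ ⟨ q , x₀ ⟩)
integral-separation {n} {x = x} {x₀} ic fx fx₀ near =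
  let u , pos , nonPos = separating-covector ic fx fx₀ near
      k , 0<k , q , eq = clear-denominators u
      0<ιk = ιℤ-mono-< {ℤ.+ 0} {k} 0<k
      q∙ = λ y → trans (sym (trans (cong (_∙ direction x₀ y) eq) (∙-·ˡ (ιℤ k) u (direction x₀ y)))) (direction-ι q x₀ y)
  in q
   , ℤP.≰⇒> (λ le → ℤP.<⇒≱
       (ιℤ-cancel-< {ℤ.+ 0} {⟨ q , x ⟩ ℤ.- ⟨ q , x₀ ⟩} (subst (0ℚ <_) (q∙ x) (*-pos 0<ιk pos)))
       (ℤP.i≤j⇒i-j≤0 le))
   , λ {y} y∈ fy → ℤP.i-j≤0⇒i≤j (ιℤ-cancel-≤ {⟨ q , y ⟩ ℤ.- ⟨ q , x₀ ⟩} {ℤ.+ 0}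
       (subst₂ _≤_ (q∙ y) (ℚP.*-zeroʳ (ιℤ k))
         (ℚP.*-monoˡ-≤-nonNeg (ιℤ k) {{ℚ.nonNegative (ℚP.<⇒≤ 0<ιk)}} (nonPos y∈ fy))))

-- Tilting a subgradient by multiples of a separating covector

addMultiple : Vec ℤ n → ℤ → Vec ℤ n → Vec ℤ n
addMultiple p k q = Vec.zipWith (λ a b → a ℤ.+ k ℤ.* b) p q

⟨addMultiple,⟩ : (p : Vec ℤ n) (k : ℤ) (q y : Vec ℤ n) → ⟨ addMultiple p k q , y ⟩ ≡ ⟨ p , y ⟩ ℤ.+ k ℤ.* ⟨ q , y ⟩
⟨addMultiple,⟩ []      k []      []      = sym (trans (ℤP.+-identityˡ _) (ℤP.*-zeroʳ k))
⟨addMultiple,⟩ (a ∷ p) k (b ∷ q) (c ∷ y) = trans (cong (λ s → (a ℤ.+ k ℤ.* b) ℤ.* c ℤ.+ s) (⟨addMultiple,⟩ p k q y))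
  (identity a k b c ⟨ p , y ⟩ ⟨ q , y ⟩)
  where
  identity : ∀ a k b c P Q → (a ℤ.+ k ℤ.* b) ℤ.* c ℤ.+ (P ℤ.+ k ℤ.* Q) ≡ a ℤ.* c ℤ.+ P ℤ.+ k ℤ.* (b ℤ.* c ℤ.+ Q)
  identity = ℤ-solve 6 (λ a k b c P Q → (a ⊞ k ⊠ b) ⊠ c ⊞ (P ⊞ k ⊠ Q) ≐ a ⊠ c ⊞ P ⊞ k ⊠ (b ⊠ c ⊞ Q)) refl

*-nonNegℤ : ∀ k {i j} → i ℤ.≤ j → ℤ.+ 0 ℤ.≤ ℤ.+ k ℤ.* (j ℤ.- i)
*-nonNegℤ k {i} {j} i≤j = subst (ℤ._≤ ℤ.+ k ℤ.* (j ℤ.- i)) (ℤP.*-zeroʳ (ℤ.+ k))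
  (ℤP.*-monoˡ-≤-nonNeg (ℤ.+ k) (ℤP.i≤j⇒0≤j-i i≤j))

-- The neighbours suffice, since `global-subgradient` is applied to the sum afterwards.
subgradient-addMultiple : ∀ {f : Vec ℤ n → ℤ∞} {x a p q} k → (∀ {y} → y ∈ neighbours x → Subgradient f x a p y) →
  (∀ {y b} → y ∈ neighbours x → f y ≡ fin b → ⟨ q , y ⟩ ℤ.≤ ⟨ q , x ⟩) →
  ∀ {y} → y ∈ neighbours x → Subgradient f x a (addMultiple p (ℤ.+ k) q) y
subgradient-addMultiple {x = x} {a} {p} {q} k sub nonPos {y} y∈ {b} fy = subst₂ ℤ._≤_
  (cong (ℤ._- b) (sym (⟨addMultiple,⟩ p (ℤ.+ k) q y))) (cong (ℤ._- a) (sym (⟨addMultiple,⟩ p (ℤ.+ k) q x)))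
  (gapℤ≤⁻¹ (ℤP.+-mono-≤ (ℤP.i≤j⇒0≤j-i (sub y∈ fy)) (*-nonNegℤ k (nonPos y∈ fy)))
    (identity (ℤ.+ k) a b ⟨ p , x ⟩ ⟨ p , y ⟩ ⟨ q , x ⟩ ⟨ q , y ⟩))
  where
  identity : ∀ k a b X Y Q R → X ℤ.+ k ℤ.* Q ℤ.- a ≡ Y ℤ.+ k ℤ.* R ℤ.- b ℤ.+ (X ℤ.- a ℤ.- (Y ℤ.- b) ℤ.+ k ℤ.* (Q ℤ.- R))
  identity = ℤ-solve 7 (λ k a b X Y Q R → X ⊞ k ⊠ Q ⊟ a ≐ Y ⊞ k ⊠ R ⊟ b ⊞ (X ⊟ a ⊟ (Y ⊟ b) ⊞ k ⊠ (Q ⊟ R))) refl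

addMultiple-large : ∀ {p q x x₀ : Vec ℤ n} {a M} → ⟨ q , x₀ ⟩ ℤ.< ⟨ q , x ⟩ → Σ ℕ λ k →
  ⟨ addMultiple p (ℤ.+ k) q , x₀ ⟩ ℤ.- a ℤ.≤ ⟨ addMultiple p (ℤ.+ k) q , x ⟩ ℤ.- M
addMultiple-large {p = p} {q} {x} {x₀} {a} {M} lt = k , subst₂ ℤ._≤_
  (cong (ℤ._- a) (sym (⟨addMultiple,⟩ p (ℤ.+ k) q x₀))) (cong (ℤ._- M) (sym (⟨addMultiple,⟩ p (ℤ.+ k) q x)))
  (gapℤ≤⁻¹ (ℤP.+-mono-≤ (ℤP.i≤j⇒0≤j-i (i≤+∣i∣ i)) (*-nonNegℤ k (ℤP.i<j⇒suc[i]≤j lt)))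
    (identity (ℤ.+ k) a M ⟨ p , x ⟩ ⟨ p , x₀ ⟩ ⟨ q , x ⟩ ⟨ q , x₀ ⟩))
  where
  -- `i` is the shortfall for `p` alone. As `q` is integral, each multiple gains at least one at `x`
  -- over `x₀`, so `∣ i ∣` multiples suffice.
  i = ⟨ p , x₀ ⟩ ℤ.- a ℤ.- (⟨ p , x ⟩ ℤ.- M)
  k = ℤ.∣ i ∣
  identity : ∀ k a M X X₀ Q Q₀ → X ℤ.+ k ℤ.* Q ℤ.- M ≡
    X₀ ℤ.+ k ℤ.* Q₀ ℤ.- a ℤ.+ (k ℤ.- (X₀ ℤ.- a ℤ.- (X ℤ.- M)) ℤ.+ k ℤ.* (Q ℤ.- (ℤ.+ 1 ℤ.+ Q₀)))
  identity = ℤ-solve 7 (λ k a M X X₀ Q Q₀ → X ⊞ k ⊠ Q ⊟ M ≐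
    X₀ ⊞ k ⊠ Q₀ ⊟ a ⊞ (k ⊟ (X₀ ⊟ a ⊟ (X ⊟ M)) ⊞ k ⊠ (Q ⊟ (ℤ-con (ℤ.+ 1) ⊞ Q₀)))) refl

subgradient : ∀ {f : Vec ℤ n → ℤ∞} {x a} → IntegrallyConvex f → f x ≡ fin a →
  Σ (Vec ℤ n) λ p → ∀ y → Subgradient f x a p y
subgradient {f = f} {x} {a} ic fx =
  let p , sub = local-subgradient (integrallyConvex⇒midpointConvex ic) x fx
  in p , global-subgradient {f = f} {x} {a} {p} ic fx sub

-- Off the effective domain the minorant may take any prescribed value M at x.
steep-minorant : ∀ {f : Vec ℤ n → ℤ∞} {x} → IntegrallyConvex f → NonemptyDom f → f x ≡ +∞ → ∀ M →
  Σ (Vec ℤ n) λ p → ∀ y → Subgradient f x M p y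
steep-minorant {n} {f} {x} ic (z , _ , fz) fx M =
  let x₀ , a , fx₀ , near = nearest f x z fz (<-wellFounded (dist x z))
      q , lt , nonPos     = integral-separation ic fx fx₀ near
      p , sub             = local-subgradient (integrallyConvex⇒midpointConvex ic) x₀ fx₀
      k , large           = addMultiple-large {p = p} {q} {x} {x₀} {a} {M} lt
      p′ = addMultiple p (ℤ.+ k) q
  in p′ , λ y fy → ℤP.≤-trans
       (global-subgradient {f = f} {x₀} {a} {p′} ic fx₀
         (subgradient-addMultiple {f = f} {x₀} {a} {p} {q} k sub nonPos) y fy)
       large

-- Conjugates

≤ₑ-trans : ∀ {u v w} → u ≤ₑ v → v ≤ₑ w → u ≤ₑ w
≤ₑ-trans -∞≤       _         = -∞≤
≤ₑ-trans (val≤ p)  (val≤ q)  = val≤ (ℤP.≤-trans p q)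
≤ₑ-trans (val≤ _)  ≤+∞       = ≤+∞
≤ₑ-trans ≤+∞       ≤+∞       = ≤+∞

≤ₑ-antisym : ∀ {u v} → u ≤ₑ v → v ≤ₑ u → u ≡ v
≤ₑ-antisym -∞≤      -∞≤      = refl
≤ₑ-antisym (val≤ p) (val≤ q) = cong val (ℤP.≤-antisym p q)
≤ₑ-antisym ≤+∞      ≤+∞      = refl

-- The hypotheses exclude `+∞ₑ` on the left and `-∞` on the right of `⊖`, the cases in which the
-- convention returns `+∞ₑ`.
⊖-mono : ∀ {u v A B} → u ≤ₑ val A → val B ≤ₑ v → (u ⊖ v) ≤ₑ val (A ℤ.- B)
⊖-mono -∞≤      (val≤ _) = -∞≤
⊖-mono -∞≤      ≤+∞      = -∞≤
⊖-mono (val≤ p) (val≤ q) = val≤ (ℤP.+-mono-≤ p (ℤP.neg-mono-≤ q))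
⊖-mono (val≤ _) ≤+∞      = -∞≤

below-all⇒≤-∞ : ∀ {v} → (∀ M → v ≤ₑ val M) → v ≤ₑ -∞
below-all⇒≤-∞ { -∞}   _ = -∞≤
below-all⇒≤-∞ {val m} h with h (ℤ.pred m)
... | val≤ m≤m-1 = ⊥-elim (ℤP.<-irrefl refl (ℤP.i≤pred[j]⇒i<j m≤m-1))
below-all⇒≤-∞ {+∞ₑ}   h with h (ℤ.+ 0)
... | ()

conjugate-≤ : ∀ {f : Vec ℤ n → ℤ∞} {p v A} → IsConjugateAt f p v →
  (∀ y {b} → f y ≡ fin b → ⟨ p , y ⟩ ℤ.- b ℤ.≤ A) → v ≤ₑ val A
conjugate-≤ {f = f} {p} {v} {A} (_ , least) h = least (val A) bound
  where
  bound : ∀ y → (val ⟨ p , y ⟩ ⊖ embed (f y)) ≤ₑ val A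
  bound y with f y in fy
  ... | fin b = val≤ (h y fy)
  ... | +∞    = -∞≤

≤-conjugate : ∀ {f : Vec ℤ n → ℤ∞} {p v x a} → IsConjugateAt f p v → f x ≡ fin a → val (⟨ p , x ⟩ ℤ.- a) ≤ₑ v
≤-conjugate {p = p} {v} {x} (upper , _) fx = subst (λ w → (val ⟨ p , x ⟩ ⊖ embed w) ≤ₑ v) fx (upper x)

module _ {g h : Vec ℤ n → ℤ∞} (gdom : NonemptyDom g) (hdom : NonemptyDom h)
  {g• h• : Vec ℤ n → Ext} (isg• : ∀ p → IsConjugateAt g p (g• p)) (ish• : ∀ p → IsConjugateAt h p (h• p)) where

  -- A subgradient `p` of `h` at `x` bounds `h• p` above by `⟨ p , x ⟩ − h x`, and `x` itself bounds
  -- `g• p` below by `⟨ p , x ⟩ − g x`; the pairing cancels in the difference.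
  dual≤primal : IntegrallyConvex h → ∀ {b} → (∀ p → b ≤ₑ (h• p ⊖ g• p)) → ∀ x → b ≤ₑ (embed (g x) ⊖ embed (h x))
  dual≤primal ich {b} b≤ x with g x in gx | h x in hx
  ... | +∞    | _     = ≤+∞
  ... | fin e | fin c = let p , sub = subgradient ich hx in
    subst (λ s → b ≤ₑ val s) (identity ⟨ p , x ⟩ c e)
      (≤ₑ-trans (b≤ p) (⊖-mono (conjugate-≤ {f = h} {p} (ish• p) (λ y → sub y)) (≤-conjugate {f = g} {p} (isg• p) gx)))
    where
    identity : ∀ X c e → X ℤ.- c ℤ.- (X ℤ.- e) ≡ e ℤ.- c
    identity = ℤ-solve 3 (λ X c e → X ⊟ c ⊟ (X ⊟ e) ≐ e ⊟ c) refl
  -- The primal value is -∞ here. A minorant of `h` with value `e − M` at `x` pushes the dual value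
  -- down to at most `M`, for every `M`.
  ... | fin e | +∞    = below-all⇒≤-∞ λ M → let p , sub = steep-minorant ich hdom hx (e ℤ.- M) in
    subst (λ s → b ≤ₑ val s) (identity ⟨ p , x ⟩ M e)
      (≤ₑ-trans (b≤ p) (⊖-mono (conjugate-≤ {f = h} {p} (ish• p) (λ y → sub y)) (≤-conjugate {f = g} {p} (isg• p) gx)))
    where
    identity : ∀ X M e → X ℤ.- (e ℤ.- M) ℤ.- (X ℤ.- e) ≡ M
    identity = ℤ-solve 3 (λ X M e → X ⊟ (e ⊟ M) ⊟ (X ⊟ e) ≐ M) refl

  -- Conjugation reverses order: `g ≥ h + a` gives `g• ≤ h• − a`. Infinite values are settled by the
  -- nonempty domains and the convention of `⊖`.
  primal≤dual : ∀ {a} → (∀ x → a ≤ₑ (embed (g x) ⊖ embed (h x))) → ∀ p → a ≤ₑ (h• p ⊖ g• p)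
  primal≤dual { -∞} _ p = -∞≤
  primal≤dual {+∞ₑ} a≤ p = ⊥-elim (g-finite (proj₂ (proj₂ gdom)) (a≤ (proj₁ gdom)))
    where
    g-finite : ∀ {x e} → g x ≡ fin e → ¬ (+∞ₑ ≤ₑ (embed (g x) ⊖ embed (h x)))
    g-finite {x} gx le rewrite gx with h x | le
    ... | fin _ | ()
    ... | +∞    | ()
  primal≤dual {val a} a≤ p with h• p in h•p
  ... | +∞ₑ   = ≤+∞
  ... | -∞    with subst (val _ ≤ₑ_) h•p (≤-conjugate {f = h} {p} (ish• p) (proj₂ (proj₂ hdom)))
  ...   | ()
  primal≤dual {val a} a≤ p | val c with g• p | conjugate-≤ {f = g} {p} {A = c ℤ.- a} (isg• p) bound
    where
    bound : ∀ x {e} → g x ≡ fin e → ⟨ p , x ⟩ ℤ.- e ℤ.≤ c ℤ.- a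
    bound x {e} gx with a≤ x
    ... | a≤x rewrite gx with h x in hx | a≤x
    -- `h x` is finite: otherwise the difference at `x` would be -∞, and `val a` could not lie below
    -- it.
    ... | fin d | val≤ a≤e-d with subst (val _ ≤ₑ_) h•p (≤-conjugate {f = h} {p} (ish• p) hx)
    ...   | val≤ X-d≤c = gapℤ≤⁻¹ (ℤP.+-mono-≤ (ℤP.i≤j⇒0≤j-i a≤e-d) (ℤP.i≤j⇒0≤j-i X-d≤c))
      (identity ⟨ p , x ⟩ a c d e)
      where
      identity : ∀ X a c d e → c ℤ.- a ≡ X ℤ.- e ℤ.+ (e ℤ.- d ℤ.- a ℤ.+ (c ℤ.- (X ℤ.- d)))
      identity = ℤ-solve 5 (λ X a c d e → c ⊟ a ≐ X ⊟ e ⊞ (e ⊟ d ⊟ a ⊞ (c ⊟ (X ⊟ d)))) refl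
  ... | -∞    | _         = ≤+∞
  ... | val e | val≤ e≤c-a = val≤ (gapℤ≤⁻¹ (ℤP.i≤j⇒0≤j-i e≤c-a) (identity a c e))
    where
    identity : ∀ a c e → c ℤ.- e ≡ a ℤ.+ (c ℤ.- a ℤ.- e)
    identity = ℤ-solve 3 (λ a c e → c ⊟ e ≐ a ⊞ (c ⊟ a ⊟ e)) refl

theorem3p14 : ∀ (n : ℕ) (g h : Vec ℤ n → ℤ∞) →
    NonemptyDom g → NonemptyDom h →
    IntegrallyConvex g → IntegrallyConvex h →
    (g• h• : Vec ℤ n → Ext) →
    (∀ p → IsConjugateAt g p (g• p)) →
    (∀ p → IsConjugateAt h p (h• p)) →
    (a b : Ext) →
    IsInf (λ x → embed (g x) ⊖ embed (h x)) a →
    IsInf (λ p → h• p ⊖ g• p) b →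
    a ≡ b
theorem3p14 n g h gdom hdom _ ich g• h• isg• ish• a b (a≤ , a-greatest) (b≤ , b-greatest) = ≤ₑ-antisym
  (b-greatest a (primal≤dual gdom hdom isg• ish• a≤))
  (a-greatest b (dual≤primal gdom hdom isg• ish• ich b≤))
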